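{- For $n\ge1$ and integer $k$, let $J^{\overline{B}}_{2n,k}$ be the number of fixed-point free signed involutions $\pi\in\mathfrak{B}_{2n}$ (i.e. $\pi^{ -1}=\pi$ and $\pi_i\ne\pm i$ for all $i$) with $\operatorname{des}^B(\pi)=k$ (so $J^{\overline{B}}_{2n,k}=0$ if $k<0$). Then $J^{\overline{B}}_{2,0}=0$, $J^{\overline{B}}_{2,1}=2$, $J^{\overline{B}}_{2,2}=0$, and for all $n\ge2$, $k\ge0$, \[ \begin{aligned} nJ^{\overline{B}}_{2n,k}={}&(k^2+k+n-1)J^{\overline{B}}_{2n-2,k}+2\big((k-1)(2n-k-1)+n\big)J^{\overline{B}}_{2n-2,k-1}\\ &+\big((2n-k)(2n-k+1)+(n-1)\big)J^{\overline{B}}_{2n-2,k-2}. \end{aligned} \]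
   Context: $\mathfrak{B}_m$ is the set of signed permutations $\pi=\pi_1\cdots\pi_m$ ($\pi_i\in\{\pm1,\dots,\pm m\}$, $|\pi_1|,\dots,|\pi_m|$ a permutation of $[m]$), with $\pi_0=0$; the inverse is defined by $\pi^{ -1}_{|\pi_i|}=\operatorname{sgn}(\pi_i)\,i$. With the natural order on $\mathbb{Z}$, $\operatorname{des}^B(\pi)=|\{i\in\{0,\dots,m-1\}:\pi_i>\pi_{i+1}\}|$. -}

module Defs where

open import Data.Nat as ℕ using (ℕ; zero; suc)
open import Data.Integer as ℤ using (ℤ; +_; -_; ∣_∣; _<_; _≤_)
import Data.Integer.Properties as ℤP
import Data.Nat.Properties as ℕP
open import Data.Fin using (Fin; toℕ)
open import Data.Fin.Properties using (all?; _≟_)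
open import Data.Vec using (Vec; []; _∷_; lookup; toList)
open import Data.List using (List; []; _∷_; concatMap; map; length; filter; upTo; _++_)
open import Data.Product using (_×_; _,_)
open import Relation.Binary.PropositionalEquality using (_≡_; _≢_)
open import Relation.Nullary using (Dec; yes; no; ¬_)
open import Relation.Nullary.Decidable using (_×-dec_; _→-dec_; ¬?)

-- A signed permutation of [m] is represented by its one-line notation
-- π = π₁ ⋯ π_m, stored as a vector of integers (index i : Fin m stands for i+1).
SignedWord : ℕ → Set
SignedWord m = Vec ℤ m

pos : ∀ {m} → Fin m → ℕ
pos i = suc (toℕ i)

IsSignedPerm : ∀ {m} → SignedWord m → Set
IsSignedPerm {m} π =
  (∀ i → (1 ℕ.≤ ∣ lookup π i ∣) × (∣ lookup π i ∣ ℕ.≤ m)) ×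
  (∀ i j → ∣ lookup π i ∣ ≡ ∣ lookup π j ∣ → i ≡ j)

-- π⁻¹ = π, where π⁻¹_{|π_i|} = sgn(π_i)·i.  Literally: for all i, j,
-- if π_i = +j then π_j = +i, and if π_i = -j then π_j = -i.
IsInvolution : ∀ {m} → SignedWord m → Set
IsInvolution π =
  ∀ i j → (lookup π i ≡ + pos j → lookup π j ≡ + pos i) ×
          (lookup π i ≡ - (+ pos j) → lookup π j ≡ - (+ pos i))

IsFixedPointFree : ∀ {m} → SignedWord m → Set
IsFixedPointFree π = ∀ i → ∣ lookup π i ∣ ≢ pos i

-- des^B: number of i ∈ {0,…,m-1} with π_i > π_{i+1}, where π_0 = 0.
descentsFrom : ℤ → List ℤ → ℕ
descentsFrom x [] = 0
descentsFrom x (y ∷ xs) with y ℤ.<? x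
... | yes _ = suc (descentsFrom y xs)
... | no  _ = descentsFrom y xs

desB : ∀ {m} → SignedWord m → ℕ
desB π = descentsFrom (+ 0) (toList π)

isSignedPerm? : ∀ {m} (π : SignedWord m) → Dec (IsSignedPerm π)
isSignedPerm? {m} π =
  all? (λ i → (1 ℕ.≤? ∣ lookup π i ∣) ×-dec (∣ lookup π i ∣ ℕ.≤? m)) ×-dec
  all? (λ i → all? (λ j → (∣ lookup π i ∣ ℕ.≟ ∣ lookup π j ∣) →-dec (i ≟ j)))

isInvolution? : ∀ {m} (π : SignedWord m) → Dec (IsInvolution π)
isInvolution? π = all? (λ i → all? (λ j →
  ((lookup π i ℤ.≟ + pos j) →-dec (lookup π j ℤ.≟ + pos i)) ×-dec
  ((lookup π i ℤ.≟ - (+ pos j)) →-dec (lookup π j ℤ.≟ - (+ pos i)))))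

isFPF? : ∀ {m} (π : SignedWord m) → Dec (IsFixedPointFree π)
isFPF? π = all? (λ i → ¬? (∣ lookup π i ∣ ℕ.≟ pos i))

words : List ℤ → (n : ℕ) → List (Vec ℤ n)
words L zero = [] ∷ []
words L (suc n) = concatMap (λ x → map (x ∷_) (words L n)) L

signedLetters : ℕ → List ℤ
signedLetters m = concatMap (λ j → + suc j ∷ - (+ suc j) ∷ []) (upTo m)

FPFInvDes : (m : ℕ) → ℤ → SignedWord m → Set
FPFInvDes m k π = IsSignedPerm π × IsInvolution π × IsFixedPointFree π × (+ desB π ≡ k)

fpfInvDes? : (m : ℕ) (k : ℤ) (π : SignedWord m) → Dec (FPFInvDes m k π)
fpfInvDes? m k π = isSignedPerm? π ×-dec isInvolution? π ×-dec isFPF? π ×-dec (+ desB π ℤ.≟ k)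

-- J^{B̄}_{m,k}: number of fixed-point free signed involutions π ∈ 𝔅_m with
-- des^B(π) = k (k an integer; automatically 0 for k < 0).
JB : ℕ → ℤ → ℕ
JB m k = length (filter (fpfInvDes? m k) (words (signedLetters m) m))

{-# OPTIONS --safe #-}
-- Label the positions of a fixed-point free signed involution π of [2n] by a weakly increasing
-- f with values in {0,…,r}, strictly increasing at the descents of π and with f₁ > 0 if π₁ < 0.
-- A given π admits as many such f as there are multisets of size 2n from r + 1 - des(π) symbols.
-- On the other hand the pairs (π , f) correspond to multisets of n symbols ±{a , b}, where the
-- arc {i , |πᵢ|} contributes sgn(πᵢ){f(i) , f(|πᵢ|)}; there are r(r+1) symbols, because +{a , a}
-- and -{0 , b} cannot occur.  Hence, writing ((c,n)) for the number of multisets of size n from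
-- c symbols,
--   Σ_k J(2n,k) ((r+1-k , 2n)) = ((r(r+1) , n))   for all r.
-- The right-hand sides satisfy n ((r(r+1) , n)) = (r(r+1) + n - 1) ((r(r+1) , n-1)).  Expanding
-- (r(r+1) + n - 1) ((r+1-d , 2n-2)) in terms of the ((r+1-k , 2n)) with k = d, d+1, d+2 turns this
-- into the recurrence, the matrix ((r+1-k , 2n)) being unitriangular in r and k.
module Submission where

open import Defs
open import Data.Nat as ℕ using (ℕ; _≤_; zero; suc; z≤n; s≤s)
open import Data.Integer using (ℤ; +_; _+_; _-_; _*_; -[1+_]; -_)
open import Data.Product using (_×_; _,_; ∃; ∃₂; proj₁; proj₂; map₂)
open import Relation.Binary.PropositionalEquality
import Data.Nat.Properties as ℕP
import Data.Nat.Tactic.RingSolver as ℕR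
open import Data.Nat.Induction using (<-rec)
import Data.Integer as ℤ
import Data.Integer.Properties as ℤP
import Data.Integer.Tactic.RingSolver as ℤR
open import Data.Bool using (Bool; true; false)
open import Data.Fin as Fin using (Fin; zero; suc; toℕ; punchIn; punchOut; fromℕ)
import Data.Fin.Properties as FinP
open import Data.List using (List; []; _∷_; _++_; length; map; applyUpTo; applyDownFrom; concatMap; filter)
open import Data.List.Membership.Propositional using (_∈_)
open import Data.List.Membership.Propositional.Properties
open import Data.List.Membership.Propositional.Properties.WithK using (unique∧set⇒bag)
import Data.List.Properties as ListP
open import Data.List.Relation.Binary.BagAndSetEquality using (∼bag⇒↭)
open import Data.List.Relation.Binary.Disjoint.Propositional using (Disjoint)
open import Data.List.Relation.Binary.Permutation.Propositional.Properties using (↭-length)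
open import Data.List.Relation.Unary.All as All using (All; []; _∷_)
import Data.List.Relation.Unary.All.Properties as AllP
open import Data.List.Relation.Unary.AllPairs as AllPairs using (AllPairs; []; _∷_)
import Data.List.Relation.Unary.AllPairs.Properties as AllPairsP
open import Data.List.Relation.Unary.Any using (here; there)
open import Data.List.Relation.Unary.Unique.Propositional using (Unique)
import Data.List.Relation.Unary.Unique.Propositional.Properties as UniqueP
open import Data.Sum as Sum using (_⊎_; inj₁; inj₂)
open import Data.Vec using (Vec; []; _∷_; lookup; tabulate; toList)
open import Data.Vec.Functional using (insertAt)
open import Data.Vec.Functional.Properties using (insertAt-lookup; insertAt-punchIn)
import Data.Vec.Properties as VecP
open import Function using (_∘_; flip; mk⇔)
open import Relation.Binary.Definitions using (tri<; tri≈; tri>)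
open import Relation.Nullary using (¬_; Dec; yes; no; contradiction)
open import Relation.Nullary.Decidable using (_×-dec_)

-- Multiset coefficients

-- Three consecutive values of k suffice for the following reason. With c = r - d and up to the
-- common factor 2n(2n-1), the coefficients ((c+1 , 2n)), ((c , 2n)) and ((c-1 , 2n)) are ((c+1 ,
-- 2n-2)) times three linearly independent quadratics in c. These span all quadratics, among them
-- r(r+1) + n - 1, so the coefficients of the recurrence are forced. The correspondence with
-- multisets is built one arc at a time, since the arcs with equal symbols still have to be arranged
-- so that π increases on blocks. The symbol (f(i) , sgn(πᵢ) f(|πᵢ|)) weakly increases with i
-- lexicographically, being a weakened image of (f(i) , πᵢ). Hence the last position carries the
-- largest symbol, and deleting its arc deletes a largest element of the multiset. Conversely, the
-- partner of the last position has the value of greatest absolute size, so it must close its block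
-- if that value is positive and open it if negative. The labels alone thus fix its place, and
-- insertion inverts deletion.

multichoose : ℕ → ℕ → ℕ
multichoose c       zero    = 1
multichoose zero    (suc n) = 0
multichoose (suc c) (suc n) = multichoose c (suc n) ℕ.+ multichoose (suc c) n

multichoose-size : ∀ c n → suc n ℕ.* multichoose c (suc n) ≡ (c ℕ.+ n) ℕ.* multichoose c n
multichoose-size zero zero = refl
multichoose-size zero (suc n) = trans (ℕP.*-zeroʳ (suc (suc n))) (sym (ℕP.*-zeroʳ (suc n)))
multichoose-size (suc c) zero = begin
  1 ℕ.* (multichoose c 1 ℕ.+ 1)      ≡⟨ ℕP.*-distribˡ-+ 1 (multichoose c 1) 1 ⟩
  1 ℕ.* multichoose c 1 ℕ.+ 1        ≡⟨ cong (ℕ._+ 1) (multichoose-size c 0) ⟩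
  (c ℕ.+ 0) ℕ.* 1 ℕ.+ 1              ≡⟨ collect c ⟩
  (suc c ℕ.+ 0) ℕ.* 1 ∎
  where
  open ≡-Reasoning
  collect : ∀ c → (c ℕ.+ 0) ℕ.* 1 ℕ.+ 1 ≡ (suc c ℕ.+ 0) ℕ.* 1
  collect = ℕR.solve-∀
multichoose-size (suc c) (suc n) = begin
  suc (suc n) ℕ.* (P ℕ.+ Q)                       ≡⟨ regroup n P Q ⟩
  suc (suc n) ℕ.* P ℕ.+ (Q ℕ.+ suc n ℕ.* Q)       ≡⟨ cong₂ (λ u v → u ℕ.+ (Q ℕ.+ v)) (multichoose-size c (suc n)) (multichoose-size (suc c) n) ⟩
  (c ℕ.+ suc n) ℕ.* X ℕ.+ (X ℕ.+ Y ℕ.+ (suc c ℕ.+ n) ℕ.* Y) ≡⟨ collect c n X Y ⟩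
  (suc c ℕ.+ suc n) ℕ.* (X ℕ.+ Y) ∎
  where
  open ≡-Reasoning
  X = multichoose c (suc n)
  Y = multichoose (suc c) n
  P = multichoose c (suc (suc n))
  Q = X ℕ.+ Y
  regroup : ∀ n p q → suc (suc n) ℕ.* (p ℕ.+ q) ≡ suc (suc n) ℕ.* p ℕ.+ (q ℕ.+ suc n ℕ.* q)
  regroup = ℕR.solve-∀
  collect : ∀ c n x y → (c ℕ.+ suc n) ℕ.* x ℕ.+ (x ℕ.+ y ℕ.+ (suc c ℕ.+ n) ℕ.* y) ≡ (suc c ℕ.+ suc n) ℕ.* (x ℕ.+ y)
  collect = ℕR.solve-∀

multichoose-symbols : ∀ c n → c ℕ.* multichoose (suc c) n ≡ (c ℕ.+ n) ℕ.* multichoose c n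
multichoose-symbols c zero = cong (ℕ._* 1) (sym (ℕP.+-identityʳ c))
multichoose-symbols c (suc n) = begin
  c ℕ.* (X ℕ.+ multichoose (suc c) n)           ≡⟨ ℕP.*-distribˡ-+ c X _ ⟩
  c ℕ.* X ℕ.+ c ℕ.* multichoose (suc c) n       ≡⟨ cong (c ℕ.* X ℕ.+_) (trans (multichoose-symbols c n) (sym (multichoose-size c n))) ⟩
  c ℕ.* X ℕ.+ suc n ℕ.* X                       ≡⟨ ℕP.*-distribʳ-+ X c (suc n) ⟨
  (c ℕ.+ suc n) ℕ.* X ∎
  where
  open ≡-Reasoning
  X = multichoose c (suc n)

multichoose-one : ∀ n → multichoose 1 n ≡ 1
multichoose-one zero    = refl
multichoose-one (suc n) = multichoose-one n

-- Used at `c + 1`, while the two variants below are used at `c` and `c - 1`: all three coefficients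
-- then become multiples of the same ((c+1 , m)).
multichoose-size² : ∀ c m → suc m ℕ.* suc (suc m) ℕ.* multichoose c (2 ℕ.+ m)
                          ≡ (c ℕ.+ suc m) ℕ.* ((c ℕ.+ m) ℕ.* multichoose c m)
multichoose-size² c m = begin
  suc m ℕ.* suc (suc m) ℕ.* W₂              ≡⟨ ℕP.*-assoc (suc m) (suc (suc m)) W₂ ⟩
  suc m ℕ.* (suc (suc m) ℕ.* W₂)            ≡⟨ cong (suc m ℕ.*_) (multichoose-size c (suc m)) ⟩
  suc m ℕ.* ((c ℕ.+ suc m) ℕ.* W₁)          ≡⟨ swap (suc m) (c ℕ.+ suc m) W₁ ⟩
  (c ℕ.+ suc m) ℕ.* (suc m ℕ.* W₁)          ≡⟨ cong ((c ℕ.+ suc m) ℕ.*_) (multichoose-size c m) ⟩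
  (c ℕ.+ suc m) ℕ.* ((c ℕ.+ m) ℕ.* multichoose c m) ∎
  where
  open ≡-Reasoning
  W₁ = multichoose c (suc m)
  W₂ = multichoose c (2 ℕ.+ m)
  swap : ∀ x y z → x ℕ.* (y ℕ.* z) ≡ y ℕ.* (x ℕ.* z)
  swap = ℕR.solve-∀

multichoose-size²′ : ∀ c m → suc m ℕ.* suc (suc m) ℕ.* multichoose c (2 ℕ.+ m)
                           ≡ (c ℕ.+ suc m) ℕ.* (c ℕ.* multichoose (suc c) m)
multichoose-size²′ c m =
  trans (multichoose-size² c m) (cong ((c ℕ.+ suc m) ℕ.*_) (sym (multichoose-symbols c m)))

multichoose-size²″ : ∀ c m → suc m ℕ.* suc (suc m) ℕ.* multichoose c (2 ℕ.+ m)
                           ≡ c ℕ.* (suc c ℕ.* multichoose (2 ℕ.+ c) m)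
multichoose-size²″ c m = begin
  _                                                    ≡⟨ multichoose-size²′ c m ⟩
  (c ℕ.+ suc m) ℕ.* (c ℕ.* multichoose (suc c) m)      ≡⟨ swap c m (multichoose (suc c) m) ⟩
  c ℕ.* ((suc c ℕ.+ m) ℕ.* multichoose (suc c) m)      ≡⟨ cong (c ℕ.*_) (multichoose-symbols (suc c) m) ⟨
  c ℕ.* (suc c ℕ.* multichoose (2 ℕ.+ c) m) ∎
  where
  open ≡-Reasoning
  swap : ∀ c m z → (c ℕ.+ suc m) ℕ.* (c ℕ.* z) ≡ c ℕ.* ((suc c ℕ.+ m) ℕ.* z)
  swap = ℕR.solve-∀

-- The coefficients of the recurrence and the polynomial identity behind them

M : ℕ → ℕ → ℤ
M c n = + multichoose c n

coeff₀ coeff₁ coeff₂ : ℤ → ℤ → ℤ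
coeff₀ n k = k * k + k + n - + 1
coeff₁ n k = + 2 * ((k - + 1) * (+ 2 * n - k - + 1) + n)
coeff₂ n k = (+ 2 * n - k) * (+ 2 * n - k + + 1) + (n - + 1)

pos-*₃ : ∀ x y z → + (x ℕ.* (y ℕ.* z)) ≡ + x * (+ y * + z)
pos-*₃ x y z = trans (ℤP.pos-* x (y ℕ.* z)) (cong (+ x *_) (ℤP.pos-* y z))

pos-*₃′ : ∀ x y z → + (x ℕ.* y ℕ.* z) ≡ + x * + y * + z
pos-*₃′ x y z = trans (ℤP.pos-* (x ℕ.* y) z) (cong (_* + z) (ℤP.pos-* x y))

-- The factor (m+1)(m+2), with m = 2n - 2, makes every multiset coefficient an explicit multiple of b.
coefficient-polynomial : ∀ m n d c b w₀ w₁ w₂ →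
  + 2 * n ≡ + 2 + m →
  (+ 1 + m) * (+ 2 + m) * w₀ ≡ (+ 2 + c + m) * ((+ 1 + c + m) * b) →
  (+ 1 + m) * (+ 2 + m) * w₁ ≡ (+ 1 + c + m) * (c * b) →
  (+ 1 + m) * (+ 2 + m) * w₂ ≡ (c - + 1) * (c * b) →
  (+ 1 + m) * (+ 2 + m) * ((n - + 1 + (d + c) * (+ 1 + (d + c))) * b)
    ≡ (+ 1 + m) * (+ 2 + m) *
      (coeff₀ n d * w₀ + coeff₁ n (+ 1 + d) * w₁ + coeff₂ n (+ 2 + d) * w₂)
coefficient-polynomial m n d c b w₀ w₁ w₂ e e₀ e₁ e₂ = begin
  L * ((n - + 1 + (d + c) * (+ 1 + (d + c))) * b)
    ≡⟨ cong (λ μ → (+ 1 + μ) * (+ 2 + μ) * ((n - + 1 + (d + c) * (+ 1 + (d + c))) * b)) m≡ ⟩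
  (+ 1 + m′) * (+ 2 + m′) * ((n - + 1 + (d + c) * (+ 1 + (d + c))) * b)
    ≡⟨ poly n d c b ⟩
  coeff₀ n d * ((+ 2 + c + m′) * ((+ 1 + c + m′) * b)) + coeff₁ n (+ 1 + d) * ((+ 1 + c + m′) * (c * b))
    + coeff₂ n (+ 2 + d) * ((c - + 1) * (c * b))
    ≡⟨ cong (λ μ → coeff₀ n d * ((+ 2 + c + μ) * ((+ 1 + c + μ) * b)) + coeff₁ n (+ 1 + d) * ((+ 1 + c + μ) * (c * b))
    + coeff₂ n (+ 2 + d) * ((c - + 1) * (c * b))) (sym m≡) ⟩
  coeff₀ n d * ((+ 2 + c + m) * ((+ 1 + c + m) * b)) + coeff₁ n (+ 1 + d) * ((+ 1 + c + m) * (c * b))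
    + coeff₂ n (+ 2 + d) * ((c - + 1) * (c * b))
    ≡⟨ cong₂ _+_ (cong₂ _+_ (cong (coeff₀ n d *_) e₀) (cong (coeff₁ n (+ 1 + d) *_) e₁)) (cong (coeff₂ n (+ 2 + d) *_) e₂) ⟨
  coeff₀ n d * (L * w₀) + coeff₁ n (+ 1 + d) * (L * w₁) + coeff₂ n (+ 2 + d) * (L * w₂)
    ≡⟨ factor L (coeff₀ n d) (coeff₁ n (+ 1 + d)) (coeff₂ n (+ 2 + d)) w₀ w₁ w₂ ⟩
  L * (coeff₀ n d * w₀ + coeff₁ n (+ 1 + d) * w₁ + coeff₂ n (+ 2 + d) * w₂) ∎
  where
  open ≡-Reasoning
  L = (+ 1 + m) * (+ 2 + m)
  -- Eliminating `m` in favour of `n` absorbs the hypothesis and leaves a polynomial identity in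
  -- free variables.
  m′ = + 2 * n - + 2
  m≡ : m ≡ m′
  m≡ = trans (solve-m m) (cong (_- + 2) (sym e))
    where
    solve-m : ∀ m → m ≡ + 2 + m - + 2
    solve-m = ℤR.solve-∀
  factor : ∀ l a₀ a₁ a₂ w₀ w₁ w₂ → a₀ * (l * w₀) + a₁ * (l * w₁) + a₂ * (l * w₂) ≡ l * (a₀ * w₀ + a₁ * w₁ + a₂ * w₂)
  factor = ℤR.solve-∀
  poly : ∀ n d c b →
    (+ 1 + (+ 2 * n - + 2)) * (+ 2 + (+ 2 * n - + 2)) * ((n - + 1 + (d + c) * (+ 1 + (d + c))) * b)
    ≡ (d * d + d + n - + 1) * ((+ 2 + c + (+ 2 * n - + 2)) * ((+ 1 + c + (+ 2 * n - + 2)) * b))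
      + (+ 2 * ((+ 1 + d - + 1) * (+ 2 * n - (+ 1 + d) - + 1) + n)) * ((+ 1 + c + (+ 2 * n - + 2)) * (c * b))
      + ((+ 2 * n - (+ 2 + d)) * (+ 2 * n - (+ 2 + d) + + 1) + (n - + 1)) * ((c - + 1) * (c * b))
  poly = ℤR.solve-∀

-- Here `suc n` is the n of the recurrence and `suc m` is 2n - 2. Both sizes are positive, so
-- coefficients with no symbols vanish, which settles `r < d`.
coefficient-identity : ∀ n m r d → 2 ℕ.* suc n ≡ 2 ℕ.+ suc m →
  + (r ℕ.* suc r ℕ.+ n) * M (suc r ℕ.∸ d) (suc m)
    ≡ coeff₀ (+ suc n) (+ d) * M (suc r ℕ.∸ d) (3 ℕ.+ m)
      + coeff₁ (+ suc n) (+ suc d) * M (suc r ℕ.∸ suc d) (3 ℕ.+ m)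
      + coeff₂ (+ suc n) (+ suc (suc d)) * M (suc r ℕ.∸ suc (suc d)) (3 ℕ.+ m)
coefficient-identity n m r d e with ℕP.≤-<-connex d r
... | inj₁ d≤r = subst Goal (ℕP.m+[n∸m]≡n d≤r) (close (r ℕ.∸ d))
  where
  Goal : ℕ → Set
  Goal r = + (r ℕ.* suc r ℕ.+ n) * M (suc r ℕ.∸ d) (suc m)
    ≡ coeff₀ (+ suc n) (+ d) * M (suc r ℕ.∸ d) (3 ℕ.+ m)
      + coeff₁ (+ suc n) (+ suc d) * M (suc r ℕ.∸ suc d) (3 ℕ.+ m)
      + coeff₂ (+ suc n) (+ suc (suc d)) * M (suc r ℕ.∸ suc (suc d)) (3 ℕ.+ m)
  -- At `c = 0` the truncated `c ℕ.∸ 1` is 0 rather than -1; the left side vanishes, and so does the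
  -- right one through its factor `c`.
  size²-pred : ∀ c → + (2 ℕ.+ m) * + (3 ℕ.+ m) * M (c ℕ.∸ 1) (3 ℕ.+ m) ≡ (+ c - + 1) * (+ c * M (suc c) (suc m))
  size²-pred zero    = trans (ℤP.*-zeroʳ (+ (2 ℕ.+ m) * + (3 ℕ.+ m))) (sym (ℤP.*-zeroʳ (+ 0 - + 1)))
  size²-pred (suc c) = trans (sym (pos-*₃′ (2 ℕ.+ m) (3 ℕ.+ m) (multichoose c (3 ℕ.+ m))))
    (trans (cong +_ (multichoose-size²″ c (suc m))) (pos-*₃ c (suc c) (multichoose (2 ℕ.+ c) (suc m))))
  -- With `r = d + c` the three numbers of symbols are `c + 1`, `c` and `c ℕ.∸ 1`.
  close : ∀ c → Goal (d ℕ.+ c)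
  close c rewrite ℕP.+-∸-assoc 1 {d ℕ.+ c} {d} (ℕP.m≤m+n d c) | ℕP.m+n∸m≡n d c
    | trans (sym (ℕP.pred[m∸n]≡m∸[1+n] (d ℕ.+ c) d)) (cong ℕ.pred (ℕP.m+n∸m≡n d c)) =
    trans (cong (_* M (suc c) (suc m)) lhs)
      (ℤP.*-cancelˡ-≡ (+ (2 ℕ.+ m) * + (3 ℕ.+ m)) _ _
        (coefficient-polynomial (+ suc m) (+ suc n) (+ d) (+ c) (M (suc c) (suc m)) _ _ _
          (cong +_ e)
          (trans (sym (pos-*₃′ (2 ℕ.+ m) (3 ℕ.+ m) (multichoose (suc c) (3 ℕ.+ m)))) (trans (cong +_ e₀) (pos-*₃ (2 ℕ.+ c ℕ.+ suc m) (suc c ℕ.+ suc m) W)))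
          (trans (sym (pos-*₃′ (2 ℕ.+ m) (3 ℕ.+ m) (multichoose c (3 ℕ.+ m)))) (trans (cong +_ e₁) (pos-*₃ (1 ℕ.+ c ℕ.+ suc m) c W)))
          (size²-pred c)))
    where
    W = multichoose (suc c) (suc m)
    e₀ : suc (suc m) ℕ.* (3 ℕ.+ m) ℕ.* multichoose (suc c) (3 ℕ.+ m) ≡ (2 ℕ.+ c ℕ.+ suc m) ℕ.* ((suc c ℕ.+ suc m) ℕ.* multichoose (suc c) (suc m))
    e₀ = trans (multichoose-size² (suc c) (suc m)) (cong (λ x → suc x ℕ.* ((suc c ℕ.+ suc m) ℕ.* W)) (ℕP.+-suc c (suc m)))
    e₁ : suc (suc m) ℕ.* (3 ℕ.+ m) ℕ.* multichoose c (3 ℕ.+ m) ≡ (1 ℕ.+ c ℕ.+ suc m) ℕ.* (c ℕ.* multichoose (suc c) (suc m))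
    e₁ = trans (multichoose-size²′ c (suc m)) (cong (ℕ._* (c ℕ.* W)) (ℕP.+-suc c (suc m)))
    lhs : + ((d ℕ.+ c) ℕ.* suc (d ℕ.+ c) ℕ.+ n) ≡ + suc n - + 1 + (+ d + + c) * (+ 1 + (+ d + + c))
    lhs = trans (ℤP.+-comm (+ ((d ℕ.+ c) ℕ.* suc (d ℕ.+ c))) (+ n)) (cong (ℤ._+_ (+ n)) (ℤP.pos-* (d ℕ.+ c) (suc (d ℕ.+ c))))
... | inj₂ r<d rewrite ℕP.m≤n⇒m∸n≡0 r<d | ℕP.m≤n⇒m∸n≡0 (ℕP.<⇒≤ r<d) | ℕP.m≤n⇒m∸n≡0 (ℕP.≤-trans (ℕP.<⇒≤ r<d) (ℕP.n≤1+n d)) =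
  vanish (+ (r ℕ.* suc r ℕ.+ n)) (coeff₀ (+ suc n) (+ d)) (coeff₁ (+ suc n) (+ suc d)) (coeff₂ (+ suc n) (+ suc (suc d)))
  where
  vanish : ∀ x a b c → x * + 0 ≡ a * + 0 + b * + 0 + c * + 0
  vanish = ℤR.solve-∀

-- Finite sums, index shifts and triangular inversion

∑< : ℕ → (ℕ → ℤ) → ℤ
∑< zero    f = + 0
∑< (suc K) f = ∑< K f + f K

∑<-cong : ∀ K {f g : ℕ → ℤ} → (∀ k → f k ≡ g k) → ∑< K f ≡ ∑< K g
∑<-cong zero    f≡g = refl
∑<-cong (suc K) f≡g = cong₂ _+_ (∑<-cong K f≡g) (f≡g K)

∑<-+ : ∀ K f g → ∑< K (λ k → f k + g k) ≡ ∑< K f + ∑< K g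
∑<-+ zero    f g = refl
∑<-+ (suc K) f g = trans (cong (_+ (f K + g K)) (∑<-+ K f g)) (interchange (∑< K f) (∑< K g) (f K) (g K))
  where
  interchange : ∀ a b c d → a + b + (c + d) ≡ a + c + (b + d)
  interchange = ℤR.solve-∀

∑<-*ˡ : ∀ K x f → ∑< K (λ k → x * f k) ≡ x * ∑< K f
∑<-*ˡ zero    x f = sym (ℤP.*-zeroʳ x)
∑<-*ˡ (suc K) x f = trans (cong (_+ x * f K) (∑<-*ˡ K x f)) (sym (ℤP.*-distribˡ-+ x (∑< K f) (f K)))

∑<-zero : ∀ K {f : ℕ → ℤ} → (∀ k → k ℕ.< K → f k ≡ + 0) → ∑< K f ≡ + 0
∑<-zero zero    f≡0 = refl
∑<-zero (suc K) f≡0 = cong₂ _+_ (∑<-zero K (λ k k<K → f≡0 k (ℕP.m<n⇒m<1+n k<K))) (f≡0 K ℕP.≤-refl)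

-- Stands for the shift to k - 1; the value 0 at `zero` matches the vanishing of J at negative
-- integers.
delay : (ℕ → ℤ) → ℕ → ℤ
delay f zero    = + 0
delay f (suc k) = f k

-- Reindexing moves the range to 1, ..., K: `delay` is zero at the missing index 0, and `g K ≡ + 0`
-- removes the extra index K.
∑<-delay : ∀ K (f g : ℕ → ℤ) → g K ≡ + 0 → ∑< K (λ k → f k * g (suc k)) ≡ ∑< K (λ k → delay f k * g k)
∑<-delay K f g gK≡0 = begin
  ∑< K (λ k → f k * g (suc k))       ≡⟨ peel K ⟨
  ∑< (suc K) (λ k → delay f k * g k) ≡⟨⟩
  ∑< K (λ k → delay f k * g k) + delay f K * g K ≡⟨ cong (λ x → ∑< K (λ k → delay f k * g k) + delay f K * x) gK≡0 ⟩
  ∑< K (λ k → delay f k * g k) + delay f K * + 0 ≡⟨ cong (ℤ._+_ (∑< K (λ k → delay f k * g k))) (ℤP.*-zeroʳ (delay f K)) ⟩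
  ∑< K (λ k → delay f k * g k) + + 0 ≡⟨ ℤP.+-identityʳ _ ⟩
  ∑< K (λ k → delay f k * g k) ∎
  where
  open ≡-Reasoning
  peel : ∀ K → ∑< (suc K) (λ k → delay f k * g k) ≡ ∑< K (λ k → f k * g (suc k))
  peel zero    = refl
  peel (suc K) = cong (_+ f K * g (suc K)) (peel K)

-- Row `r` involves only `x 0`, ..., `x r` and has diagonal coefficient ((1 , m)) = 1, so strong
-- induction isolates `x k` in row `k`.
triangular : ∀ m (x : ℕ → ℤ) → (∀ r → ∑< (suc r) (λ k → x k * M (suc r ℕ.∸ k) m) ≡ + 0) → ∀ k → x k ≡ + 0
triangular m x vanishes = <-rec (λ k → x k ≡ + 0) step
  where
  open ≡-Reasoning
  step : ∀ k → (∀ {l} → l ℕ.< k → x l ≡ + 0) → x k ≡ + 0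
  step k ih = begin
    x k                            ≡⟨ ℤP.*-identityʳ (x k) ⟨
    x k * + 1                      ≡⟨ cong (λ c → x k * + c) (multichoose-one m) ⟨
    x k * M 1 m                    ≡⟨ cong (λ c → x k * M c m) (trans (ℕP.+-∸-assoc 1 (ℕP.≤-refl {k})) (cong suc (ℕP.n∸n≡0 k))) ⟨
    x k * M (suc k ℕ.∸ k) m        ≡⟨ ℤP.+-identityˡ _ ⟨
    + 0 + x k * M (suc k ℕ.∸ k) m  ≡⟨ cong (_+ x k * M (suc k ℕ.∸ k) m)
                                        (∑<-zero k (λ l l<k → cong (_* M (suc k ℕ.∸ l) m) (ih l<k))) ⟨
    ∑< (suc k) (λ l → x l * M (suc k ℕ.∸ l) m) ≡⟨ vanishes k ⟩
    + 0 ∎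

M-vanish : ∀ k m → M (k ℕ.∸ k) (suc m) ≡ + 0
M-vanish k m = cong (λ c → M c (suc m)) (ℕP.n∸n≡0 k)

-- From the expansions of two sequences to the recurrence

module _ (n m : ℕ) (2n≡2+m : 2 ℕ.* suc n ≡ 2 ℕ.+ suc m) (J J′ : ℕ → ℤ)
  (expand  : ∀ r → ∑< (suc r) (λ k → J k * M (suc r ℕ.∸ k) (3 ℕ.+ m)) ≡ M (r ℕ.* suc r) (suc n))
  (expand′ : ∀ r → ∑< (suc r) (λ k → J′ k * M (suc r ℕ.∸ k) (suc m)) ≡ M (r ℕ.* suc r) n)
  where

  private
    N = + suc n
    R : ℕ → ℤ
    R k = coeff₀ N (+ k) * J′ k + coeff₁ N (+ k) * delay J′ k + coeff₂ N (+ k) * delay (delay J′) k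

  module _ (r : ℕ) where
    private
      w : ℕ → ℤ
      w k = M (suc r ℕ.∸ k) (3 ℕ.+ m)

      open ≡-Reasoning

      shift₁ : ∑< (suc r) (λ k → J′ k * (coeff₁ N (+ suc k) * w (suc k))) ≡ ∑< (suc r) (λ k → delay J′ k * (coeff₁ N (+ k) * w k))
      shift₁ = ∑<-delay (suc r) J′ (λ k → coeff₁ N (+ k) * w k)
        (trans (cong (coeff₁ N (+ suc r) *_) (M-vanish (suc r) (2 ℕ.+ m))) (ℤP.*-zeroʳ (coeff₁ N (+ suc r))))

      shift₂ : ∑< (suc r) (λ k → J′ k * (coeff₂ N (+ suc (suc k)) * w (suc (suc k)))) ≡ ∑< (suc r) (λ k → delay (delay J′) k * (coeff₂ N (+ k) * w k))
      shift₂ = trans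
        (∑<-delay (suc r) J′ (λ k → coeff₂ N (+ suc k) * w (suc k))
          (trans (cong (λ c → coeff₂ N (+ suc (suc r)) * M c (3 ℕ.+ m)) (ℕP.m≤n⇒m∸n≡0 (ℕP.n≤1+n r))) (ℤP.*-zeroʳ (coeff₂ N (+ suc (suc r))))))
        (∑<-delay (suc r) (delay J′) (λ k → coeff₂ N (+ k) * w k)
          (trans (cong (coeff₂ N (+ suc r) *_) (M-vanish (suc r) (2 ℕ.+ m))) (ℤP.*-zeroʳ (coeff₂ N (+ suc r)))))

      distribute : ∀ j a₀ a₁ a₂ w₀ w₁ w₂ → j * (a₀ * w₀ + a₁ * w₁ + a₂ * w₂) ≡ j * (a₀ * w₀) + j * (a₁ * w₁) + j * (a₂ * w₂)
      distribute = ℤR.solve-∀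
      gather : ∀ j₀ j₁ j₂ a₀ a₁ a₂ w → j₀ * (a₀ * w) + j₁ * (a₁ * w) + j₂ * (a₂ * w) ≡ (a₀ * j₀ + a₁ * j₁ + a₂ * j₂) * w
      gather = ℤR.solve-∀
      swap : ∀ x y z → x * (y * z) ≡ y * (x * z)
      swap = ℤR.solve-∀

      ∑<-+₃ : ∀ K f g h → ∑< K (λ k → f k + g k + h k) ≡ ∑< K f + ∑< K g + ∑< K h
      ∑<-+₃ K f g h = trans (∑<-+ K (λ k → f k + g k) h) (cong (_+ ∑< K h) (∑<-+ K f g))

    weighted-recurrence : N * ∑< (suc r) (λ k → J k * w k) ≡ ∑< (suc r) (λ k → R k * w k)
    weighted-recurrence = begin
      N * ∑< (suc r) (λ k → J k * w k)        ≡⟨ cong (N *_) (expand r) ⟩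
      N * M c (suc n)                         ≡⟨ ℤP.pos-* (suc n) (multichoose c (suc n)) ⟨
      + (suc n ℕ.* multichoose c (suc n))     ≡⟨ cong +_ (multichoose-size c n) ⟩
      + ((c ℕ.+ n) ℕ.* multichoose c n)       ≡⟨ ℤP.pos-* (c ℕ.+ n) (multichoose c n) ⟩
      + (c ℕ.+ n) * M c n                     ≡⟨ cong (+ (c ℕ.+ n) *_) (expand′ r) ⟨
      + (c ℕ.+ n) * ∑< (suc r) (λ k → J′ k * M (suc r ℕ.∸ k) (suc m)) ≡⟨ ∑<-*ˡ (suc r) (+ (c ℕ.+ n)) (λ k → J′ k * M (suc r ℕ.∸ k) (suc m)) ⟨
      ∑< (suc r) (λ k → + (c ℕ.+ n) * (J′ k * M (suc r ℕ.∸ k) (suc m))) ≡⟨ ∑<-cong (suc r) (λ k → trans (swap (+ (c ℕ.+ n)) (J′ k) (M (suc r ℕ.∸ k) (suc m)))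
           (trans (cong (J′ k *_) (coefficient-identity n m r k 2n≡2+m))
             (distribute (J′ k) (coeff₀ N (+ k)) (coeff₁ N (+ suc k)) (coeff₂ N (+ suc (suc k))) (w k) (w (suc k)) (w (suc (suc k)))))) ⟩
      ∑< (suc r) (λ k → J′ k * (coeff₀ N (+ k) * w k) + J′ k * (coeff₁ N (+ suc k) * w (suc k)) + J′ k * (coeff₂ N (+ suc (suc k)) * w (suc (suc k))))
        ≡⟨ ∑<-+₃ (suc r) (λ k → J′ k * (coeff₀ N (+ k) * w k)) (λ k → J′ k * (coeff₁ N (+ suc k) * w (suc k))) (λ k → J′ k * (coeff₂ N (+ suc (suc k)) * w (suc (suc k)))) ⟩
      -- After the shifts every summand carries the same `w k`, and the coefficients at k, k + 1 and
      -- k + 2 have all become coefficients at k.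
      _ ≡⟨ cong₂ (λ x y → ∑< (suc r) (λ k → J′ k * (coeff₀ N (+ k) * w k)) + x + y) shift₁ shift₂ ⟩
      _ ≡⟨ ∑<-+₃ (suc r) (λ k → J′ k * (coeff₀ N (+ k) * w k)) (λ k → delay J′ k * (coeff₁ N (+ k) * w k)) (λ k → delay (delay J′) k * (coeff₂ N (+ k) * w k)) ⟨
      ∑< (suc r) (λ k → J′ k * (coeff₀ N (+ k) * w k) + delay J′ k * (coeff₁ N (+ k) * w k) + delay (delay J′) k * (coeff₂ N (+ k) * w k))
        ≡⟨ ∑<-cong (suc r) (λ k → gather (J′ k) (delay J′ k) (delay (delay J′) k) (coeff₀ N (+ k)) (coeff₁ N (+ k)) (coeff₂ N (+ k)) (w k)) ⟩
      ∑< (suc r) (λ k → R k * w k) ∎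
      where c = r ℕ.* suc r

  recurrence : ∀ k → N * J k ≡ R k
  recurrence k = ℤP.i-j≡0⇒i≡j (N * J k) (R k) (triangular (3 ℕ.+ m) (λ k → N * J k - R k) vanishes k)
    where
    open ≡-Reasoning
    split : ∀ n j r w → (n * j - r) * w ≡ n * (j * w) + - + 1 * (r * w)
    split = ℤR.solve-∀
    cancel : ∀ x → x + - + 1 * x ≡ + 0
    cancel = ℤR.solve-∀
    vanishes : ∀ r → ∑< (suc r) (λ k → (N * J k - R k) * M (suc r ℕ.∸ k) (3 ℕ.+ m)) ≡ + 0
    vanishes r = begin
      ∑< (suc r) (λ k → (N * J k - R k) * w k)                    ≡⟨ ∑<-cong (suc r) (λ k → split N (J k) (R k) (w k)) ⟩
      ∑< (suc r) (λ k → N * (J k * w k) + - + 1 * (R k * w k))    ≡⟨ ∑<-+ (suc r) (λ k → N * (J k * w k)) (λ k → - + 1 * (R k * w k)) ⟩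
      ∑< (suc r) (λ k → N * (J k * w k)) + ∑< (suc r) (λ k → - + 1 * (R k * w k))
        ≡⟨ cong₂ _+_ (trans (∑<-*ˡ (suc r) N (λ k → J k * w k)) (weighted-recurrence r)) (∑<-*ˡ (suc r) (- + 1) (λ k → R k * w k)) ⟩
      ∑< (suc r) (λ k → R k * w k) + - + 1 * ∑< (suc r) (λ k → R k * w k) ≡⟨ cancel (∑< (suc r) (λ k → R k * w k)) ⟩
      + 0 ∎
      where
      w : ℕ → ℤ
      w k = M (suc r ℕ.∸ k) (3 ℕ.+ m)

-- Labelled involutions and insertion of their last arc

data Signed (A : Set) : Set where
  minus plus : A → Signed A

∣_∣ : ∀ {A} → Signed A → A
∣ minus a ∣ = a
∣ plus a ∣ = a

smap : ∀ {A B} → (A → B) → Signed A → Signed B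
smap f (minus a) = minus (f a)
smap f (plus a) = plus (f a)

infix 6 _<$_
_<$_ : ∀ {A B} → B → Signed A → Signed B
b <$ x = smap (λ _ → b) x

∣∣-smap : ∀ {A B} (f : A → B) x → ∣ smap f x ∣ ≡ f ∣ x ∣
∣∣-smap f (minus a) = refl
∣∣-smap f (plus a) = refl

smap-∘ : ∀ {A B C} (g : B → C) (f : A → B) x → smap g (smap f x) ≡ smap (g ∘ f) x
smap-∘ g f (minus a) = refl
smap-∘ g f (plus a) = refl

smap-cong : ∀ {A B} {f g : A → B} → (∀ a → f a ≡ g a) → ∀ x → smap f x ≡ smap g x
smap-cong f≡g (minus a) = cong minus (f≡g a)
smap-cong f≡g (plus a) = cong plus (f≡g a)

smap-injective : ∀ {A B} {f : A → B} → (∀ {a b} → f a ≡ f b → a ≡ b) → ∀ {x y} → smap f x ≡ smap f y → x ≡ y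
smap-injective inj {minus a} {minus b} eq = cong minus (inj (cong ∣_∣ eq))
smap-injective inj {plus a} {plus b} eq = cong plus (inj (cong ∣_∣ eq))

∣∣-<$ : ∀ {A B} {b : B} (x : Signed A) → ∣ b <$ x ∣ ≡ b
∣∣-<$ {b = b} x = ∣∣-smap (λ _ → b) x

<$-∣∣ : ∀ {A} (x : Signed A) → ∣ x ∣ <$ x ≡ x
<$-∣∣ (minus _) = refl
<$-∣∣ (plus _) = refl

-- Parametrised by the relation on magnitudes: with `<` on positions it compares values of π, with
-- `≤` on labels it compares symbols, and `signedRel-map` passes from one to the other.
data SignedRel {A : Set} (R : A → A → Set) : Signed A → Signed A → Set where
  minus     : ∀ {a b} → R b a → SignedRel R (minus a) (minus b)
  minus-plus : ∀ {a b} → SignedRel R (minus a) (plus b)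
  plus     : ∀ {a b} → R a b → SignedRel R (plus a) (plus b)

Lex : ∀ {A} → (A → A → Set) → ℕ × Signed A → ℕ × Signed A → Set
Lex R (l , x) (l′ , y) = l ℕ.< l′ ⊎ (l ≡ l′ × SignedRel R x y)

signedRel-map : ∀ {A B} {R : A → A → Set} {S : B → B → Set} {f : A → B} →
                (∀ {a b} → R a b → S (f a) (f b)) → ∀ {x y} → SignedRel R x y → SignedRel S (smap f x) (smap f y)
signedRel-map m (minus r) = minus (m r)
signedRel-map m minus-plus = minus-plus
signedRel-map m (plus r) = plus (m r)

lex-map : ∀ {A B} {R : A → A → Set} {S : B → B → Set} {f : A → B} →
          (∀ {a b} → R a b → S (f a) (f b)) → ∀ {k k′} → Lex R k k′ → Lex S (map₂ (smap f) k) (map₂ (smap f) k′)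
lex-map m (inj₁ l<l′)      = inj₁ l<l′
lex-map m (inj₂ (l≡l′ , r)) = inj₂ (l≡l′ , signedRel-map m r)

signedRel-trans : ∀ {A} {R : A → A → Set} → (∀ {a b c} → R a b → R b c → R a c) →
                  ∀ {x y z} → SignedRel R x y → SignedRel R y z → SignedRel R x z
signedRel-trans t (minus r) (minus s) = minus (t s r)
signedRel-trans t (minus r) minus-plus = minus-plus
signedRel-trans t minus-plus (plus s) = minus-plus
signedRel-trans t (plus r) (plus s) = plus (t r s)

lex-trans : ∀ {A} {R : A → A → Set} → (∀ {a b c} → R a b → R b c → R a c) →
            ∀ {k k′ k″} → Lex R k k′ → Lex R k′ k″ → Lex R k k″
lex-trans t (inj₁ p)          (inj₁ q)          = inj₁ (ℕP.<-trans p q)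
lex-trans t (inj₁ p)          (inj₂ (refl , _)) = inj₁ p
lex-trans t (inj₂ (refl , _)) (inj₁ q)          = inj₁ q
lex-trans t (inj₂ (refl , r)) (inj₂ (refl , s)) = inj₂ (refl , signedRel-trans t r s)

signedRel-unmap : ∀ {A B} {R : A → A → Set} {S : B → B → Set} {f : A → B} →
                  (∀ {a b} → S (f a) (f b) → R a b) → ∀ x y → SignedRel S (smap f x) (smap f y) → SignedRel R x y
signedRel-unmap m (minus _) (minus _) (minus r) = minus (m r)
signedRel-unmap m (minus _) (plus _) minus-plus = minus-plus
signedRel-unmap m (plus _) (plus _) (plus r) = plus (m r)

lex⇒≤ : ∀ {A} {R : A → A → Set} {k k′} → Lex R k k′ → proj₁ k ≤ proj₁ k′
lex⇒≤ (inj₁ l<l′)        = ℕP.<⇒≤ l<l′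
lex⇒≤ (inj₂ (refl , _)) = ℕP.≤-refl

lex-resolve : ∀ {A} {R : A → A → Set} {l x l′ y} → Lex R (l , x) (l′ , y) → ¬ SignedRel R x y → l ℕ.< l′
lex-resolve (inj₁ l<l′)       _   = l<l′
lex-resolve (inj₂ (_ , r)) ¬r = contradiction r ¬r

-- A symbol (a , ±b) stands for the arcs joining the blocks labelled a and b, with that sign.
Symbol : Set
Symbol = ℕ × Signed ℕ

infix 4 _≼_ _≺_
_≼_ _≺_ : Symbol → Symbol → Set
_≼_ = Lex ℕ._≤_
_≺_ = Lex ℕ._<_

≼-refl : ∀ {x} → x ≼ x
≼-refl {_ , minus _} = inj₂ (refl , minus ℕP.≤-refl)
≼-refl {_ , plus _} = inj₂ (refl , plus ℕP.≤-refl)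

≼-trans : ∀ {x y z} → x ≼ y → y ≼ z → x ≼ z
≼-trans = lex-trans ℕP.≤-trans

≺⇒≼ : ∀ {x y} → x ≺ y → x ≼ y
≺⇒≼ (inj₁ l<l′)             = inj₁ l<l′
≺⇒≼ (inj₂ (eq , minus r))   = inj₂ (eq , minus (ℕP.<⇒≤ r))
≺⇒≼ (inj₂ (eq , minus-plus)) = inj₂ (eq , minus-plus)
≺⇒≼ (inj₂ (eq , plus r))   = inj₂ (eq , plus (ℕP.<⇒≤ r))

≺⇒⋡ : ∀ {x y} → x ≺ y → ¬ (y ≼ x)
≺⇒⋡ (inj₁ p)                 q = ℕP.<⇒≱ p (lex⇒≤ q)
≺⇒⋡ (inj₂ (refl , _))        (inj₁ q) = ℕP.<-irrefl refl q
≺⇒⋡ (inj₂ (refl , minus r))    (inj₂ (_ , minus s)) = ℕP.<⇒≱ r s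
≺⇒⋡ (inj₂ (refl , plus r))    (inj₂ (_ , plus s)) = ℕP.<⇒≱ r s
≺⇒⋡ (inj₂ (refl , minus-plus)) (inj₂ (_ , ()))

-- Arcs are recorded from their larger end, so a ≥ b; no arc joins a block to itself positively,
-- since π increases on blocks, and the block labelled 0 carries no negative values.
data Canonical : Symbol → Set where
  minus : ∀ {a b} → 1 ≤ b → b ≤ a → Canonical (a , minus b)
  plus : ∀ {a b} → b ℕ.< a → Canonical (a , plus b)

-- Positions after adjoining an arc: the last one, its partner, the old ones

module _ {m : ℕ} where
  top : Fin (2 ℕ.+ m)
  top = fromℕ (suc m)

  mid : Fin (suc m) → Fin (2 ℕ.+ m)
  mid j = punchIn top j

  old : Fin (suc m) → Fin m → Fin (2 ℕ.+ m)
  old j i = punchIn top (punchIn j i)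

  data View (j : Fin (suc m)) : Fin (2 ℕ.+ m) → Set where
    isTop : View j top
    isMid : View j (mid j)
    isOld : ∀ i → View j (old j i)

  view : ∀ j u → View j u
  view j u with top Fin.≟ u
  ... | yes refl = isTop
  ... | no t≢u = subst (View j) (FinP.punchIn-punchOut t≢u) (lower (punchOut t≢u))
    where
    lower : ∀ v → View j (punchIn top v)
    lower v with j Fin.≟ v
    ... | yes refl = isMid
    ... | no j≢v = subst (λ w → View j (punchIn top w)) (FinP.punchIn-punchOut j≢v) (isOld (punchOut j≢v))

  module _ {A : Set} (j : Fin (suc m)) (a b : A) (g : Fin m → A) where
    glue : Fin (2 ℕ.+ m) → A
    glue = insertAt (insertAt g j b) top a

    glue-top : glue top ≡ a
    glue-top = insertAt-lookup (insertAt g j b) top a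

    glue-mid : glue (mid j) ≡ b
    glue-mid = trans (insertAt-punchIn (insertAt g j b) top a j) (insertAt-lookup g j b)

    glue-old : ∀ i → glue (old j i) ≡ g i
    glue-old i = trans (insertAt-punchIn (insertAt g j b) top a (punchIn j i)) (insertAt-punchIn g j b i)

  mid≢top : ∀ {j} → mid j ≢ top
  mid≢top = FinP.punchInᵢ≢i top _

  mid<top : ∀ j → mid j Fin.< top
  mid<top j = FinP.≤∧≢⇒< (FinP.≤fromℕ (mid j)) mid≢top

  top≮ : ∀ u → ¬ (top Fin.< u)
  top≮ u top<u = ℕP.<⇒≱ top<u (FinP.≤fromℕ u)

punchIn-mono-< : ∀ {m} (j : Fin (suc m)) {i i′} → i Fin.< i′ → punchIn j i Fin.< punchIn j i′
punchIn-mono-< j {i} {i′} i<i′ = ℕP.≰⇒> (λ ≥ → ℕP.<⇒≱ i<i′ (FinP.punchIn-cancel-≤ j i′ i ≥))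

punchIn-cancel-< : ∀ {m} (j : Fin (suc m)) {i i′} → punchIn j i Fin.< punchIn j i′ → i Fin.< i′
punchIn-cancel-< j {i} {i′} lt = ℕP.≰⇒> (λ ≥ → ℕP.<⇒≱ lt (FinP.punchIn-mono-≤ j i′ i ≥))

module _ {m : ℕ} (j : Fin (suc m)) where
  old-mono : ∀ {i i′} → i Fin.< i′ → old j i Fin.< old j i′
  old-mono = punchIn-mono-< top ∘ punchIn-mono-< j

  old-cancel : ∀ {i i′} → old j i Fin.< old j i′ → i Fin.< i′
  old-cancel = punchIn-cancel-< j ∘ punchIn-cancel-< top

  old-injective : ∀ {i i′} → old j i ≡ old j i′ → i ≡ i′
  old-injective = FinP.punchIn-injective j _ _ ∘ FinP.punchIn-injective top _ _

  mid≢old : ∀ {i} → mid j ≢ old j i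
  mid≢old eq = FinP.punchInᵢ≢i j _ (sym (FinP.punchIn-injective top _ _ eq))

record IsCut {m} (f : Fin m → ℕ) (t : ℕ) (j : Fin (suc m)) : Set where
  field
    below : ∀ i → punchIn j i Fin.< j → f i ℕ.< t
    above : ∀ i → j Fin.< punchIn j i → t ≤ f i

cut : ∀ {m} → (Fin m → ℕ) → ℕ → Fin (suc m)
cut {zero}  f t = zero
cut {suc m} f t with f zero ℕ.<? t
... | yes _ = suc (cut (f ∘ suc) t)
... | no  _ = zero

cut-isCut : ∀ {m} (f : Fin m → ℕ) t → (∀ {i j} → i Fin.≤ j → f i ≤ f j) → IsCut f t (cut f t)
cut-isCut {zero}  f t mono = record { below = λ () ; above = λ () }
cut-isCut {suc m} f t mono with f zero ℕ.<? t
... | no f0≮t = record { below = λ _ () ; above = λ i _ → ℕP.≤-trans (ℕP.≮⇒≥ f0≮t) (mono {zero} {i} z≤n) }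
... | yes f0<t = record
  { below = λ { zero _ → f0<t ; (suc i) (s≤s lt) → IsCut.below rest i lt }
  ; above = λ { (suc i) (s≤s lt) → IsCut.above rest i lt } }
  where rest = cut-isCut (f ∘ suc) t (λ {i} {j} le → mono {suc i} {suc j} (s≤s le))

-- Lets deletion be undone: the place a deleted partner occupied is a cut for its threshold, hence
-- the one that `insert` computes.
isCut-unique : ∀ {m} (f : Fin m → ℕ) t {j j′} → IsCut f t j → IsCut f t j′ → j ≡ j′
isCut-unique f t {zero} {zero} c c′ = refl
isCut-unique {suc m} f t {zero} {suc j′} c c′ =
  contradiction (IsCut.above c zero (s≤s z≤n)) (ℕP.<⇒≱ (IsCut.below c′ zero (s≤s z≤n)))
isCut-unique {suc m} f t {suc j} {zero} c c′ =
  contradiction (IsCut.above c′ zero (s≤s z≤n)) (ℕP.<⇒≱ (IsCut.below c zero (s≤s z≤n)))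
isCut-unique {suc m} f t {suc j} {suc j′} c c′ =
  cong suc (isCut-unique (f ∘ suc) t (shift c) (shift c′))
  where
  shift : ∀ {j} → IsCut f t (suc j) → IsCut (f ∘ suc) t j
  shift c = record { below = λ i lt → IsCut.below c (suc i) (s≤s lt) ; above = λ i lt → IsCut.above c (suc i) (s≤s lt) }

-- o i = (f i , πᵢ): a label together with a signed value.
Labelled : ℕ → Set
Labelled m = Fin m → ℕ × Signed (Fin m)

module _ {m : ℕ} (o : Labelled m) where
  label : Fin m → ℕ
  label i = proj₁ (o i)

  value : Fin m → Signed (Fin m)
  value i = proj₂ (o i)

  symbol : Fin m → Symbol
  symbol i = map₂ (smap label) (o i)

  -- `increasing` combines weak growth of the labels with strict growth at descents. `negative`
  -- concerns all positions instead of the first only; this is equivalent, because π increases on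
  -- the block labelled 0, which would start at the first position.
  record Valid : Set where
    field
      involutive     : ∀ i → value ∣ value i ∣ ≡ i <$ value i
      fixedPointFree : ∀ i → ∣ value i ∣ ≢ i
      increasing     : ∀ i j → i Fin.< j → Lex Fin._<_ (o i) (o j)
      negative       : ∀ {i j} → value i ≡ minus j → 1 ≤ label i

    label-mono : ∀ {i j} → i Fin.≤ j → label i ≤ label j
    label-mono {i} {j} i≤j with ℕP.m≤n⇒m<n∨m≡n i≤j
    ... | inj₁ i<j = lex⇒≤ (increasing i j i<j)
    ... | inj₂ i≡j = ℕP.≤-reflexive (cong label (FinP.toℕ-injective i≡j))

    -- Labels grow weakly with positions, so replacing partners by their labels only weakens the
    -- comparison. In particular the last position carries the largest symbol.
    symbol-mono : ∀ i j → i Fin.< j → symbol i ≼ symbol j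
    symbol-mono i j i<j = lex-map (label-mono ∘ ℕP.<⇒≤) (increasing i j i<j)

-- Counts the labels before the partner of the last position: a positive partner ends its block,
-- a negative one starts it.
threshold : Signed ℕ → ℕ
threshold (minus b) = b
threshold (plus b) = suc b

insertAtCut : ∀ {m} → Fin (suc m) → Symbol → Labelled m → Labelled (2 ℕ.+ m)
insertAtCut j (a , ℓ) o = glue j (a , mid j <$ ℓ) (∣ ℓ ∣ , top <$ ℓ) (map₂ (smap (old j)) ∘ o)

insert : ∀ {m} → Symbol → Labelled m → Labelled (2 ℕ.+ m)
insert x o = insertAtCut (cut (label o) (threshold (proj₂ x))) x o

module _ {m : ℕ} (j : Fin (suc m)) (a : ℕ) (ℓ : Signed ℕ) (o : Labelled m) where
  private
    o⁺ = insertAtCut j (a , ℓ) o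

  insert-top : o⁺ top ≡ (a , mid j <$ ℓ)
  insert-top = glue-top j _ _ _

  insert-mid : o⁺ (mid j) ≡ (∣ ℓ ∣ , top <$ ℓ)
  insert-mid = glue-mid j _ _ _

  insert-old : ∀ i → o⁺ (old j i) ≡ map₂ (smap (old j)) (o i)
  insert-old i = glue-old j _ _ _ i

  symbol-insert-top : symbol o⁺ top ≡ (a , ℓ)
  symbol-insert-top = trans (cong (map₂ (smap (label o⁺))) insert-top) (cong (a ,_) (go ℓ (cong proj₁ insert-mid)))
    where
    go : ∀ ℓ → label o⁺ (mid j) ≡ ∣ ℓ ∣ → smap (label o⁺) (mid j <$ ℓ) ≡ ℓ
    go (minus _) eq = cong minus eq
    go (plus _) eq = cong plus eq

  symbol-insert-mid : symbol o⁺ (mid j) ≡ (∣ ℓ ∣ , a <$ ℓ)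
  symbol-insert-mid = trans (cong (map₂ (smap (label o⁺))) insert-mid) (cong (∣ ℓ ∣ ,_) (go ℓ (cong proj₁ insert-top)))
    where
    go : ∀ ℓ → label o⁺ top ≡ a → smap (label o⁺) (top <$ ℓ) ≡ a <$ ℓ
    go (minus _) eq = cong minus eq
    go (plus _) eq = cong plus eq

  symbol-insert-old : ∀ i → symbol o⁺ (old j i) ≡ symbol o i
  symbol-insert-old i = trans (cong (map₂ (smap (label o⁺))) (insert-old i))
    (cong (label o i ,_) (trans (smap-∘ (label o⁺) (old j) (value o i)) (smap-cong (cong proj₁ ∘ insert-old) (value o i))))

-- The left symbol is the same arc read from its other end; a tie of labels occurs only for a
-- negative arc within one block, where both readings coincide.
transpose≼ : ∀ {a ℓ} → Canonical (a , ℓ) → (∣ ℓ ∣ , a <$ ℓ) ≼ (a , ℓ)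
transpose≼ (plus b<a) = inj₁ b<a
transpose≼ (minus 1≤b b≤a) with ℕP.m≤n⇒m<n∨m≡n b≤a
... | inj₁ b<a  = inj₁ b<a
... | inj₂ refl = ≼-refl

module _ {m : ℕ} {a : ℕ} {ℓ : Signed ℕ} {o : Labelled m} (canonical : Canonical (a , ℓ))
         (valid : Valid o) (maximal : ∀ i → symbol o i ≼ (a , ℓ)) where
  open Valid valid

  private
    j = cut (label o) (threshold ℓ)
    isCut = cut-isCut (label o) (threshold ℓ) label-mono
    open IsCut isCut
    o⁺ = insert (a , ℓ) o

    value-top : value o⁺ top ≡ mid j <$ ℓ
    value-top = cong proj₂ (insert-top j a ℓ o)
    value-mid : value o⁺ (mid j) ≡ top <$ ℓ
    value-mid = cong proj₂ (insert-mid j a ℓ o)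
    value-old : ∀ i → value o⁺ (old j i) ≡ smap (old j) (value o i)
    value-old i = cong proj₂ (insert-old j a ℓ o i)

    involutive⁺ : ∀ u → value o⁺ ∣ value o⁺ u ∣ ≡ u <$ value o⁺ u
    involutive⁺ u with view j u
    ... | isTop rewrite value-top | ∣∣-<$ {b = mid j} ℓ | value-mid = sym (smap-∘ (λ _ → top) (λ _ → mid j) ℓ)
    ... | isMid rewrite value-mid | ∣∣-<$ {b = top {m}} ℓ | value-top = sym (smap-∘ (λ _ → mid j) (λ _ → top) ℓ)
    ... | isOld i rewrite value-old i | ∣∣-smap (old j) (value o i) | value-old ∣ value o i ∣ | involutive i =
      trans (smap-∘ (old j) (λ _ → i) (value o i)) (sym (smap-∘ (λ _ → old j i) (old j) (value o i)))

    fixedPointFree⁺ : ∀ u → ∣ value o⁺ u ∣ ≢ u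
    fixedPointFree⁺ u with view j u
    ... | isTop rewrite value-top | ∣∣-<$ {b = mid j} ℓ = mid≢top
    ... | isMid rewrite value-mid | ∣∣-<$ {b = top {m}} ℓ = mid≢top ∘ sym
    ... | isOld i rewrite value-old i | ∣∣-smap (old j) (value o i) = fixedPointFree i ∘ old-injective j

    negative⁺ : ∀ {u v} → value o⁺ u ≡ minus v → 1 ≤ label o⁺ u
    negative⁺ {u} eq with view j u
    ... | isTop = subst (1 ≤_) (sym (cong proj₁ (insert-top j a ℓ o))) (go canonical (trans (sym value-top) eq))
      where
      go : ∀ {ℓ k} → Canonical (a , ℓ) → mid j <$ ℓ ≡ minus k → 1 ≤ a
      go (minus 1≤b b≤a) _ = ℕP.≤-trans 1≤b b≤a
    ... | isMid = subst (1 ≤_) (sym (cong proj₁ (insert-mid j a ℓ o))) (go canonical (trans (sym value-mid) eq))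
      where
      go : ∀ {ℓ k} → Canonical (a , ℓ) → top {m} <$ ℓ ≡ minus k → 1 ≤ ∣ ℓ ∣
      go (minus 1≤b b≤a) _ = 1≤b
    ... | isOld i = subst (1 ≤_) (sym (cong proj₁ (insert-old j a ℓ o i))) (go (value o i) refl (trans (sym (value-old i)) eq))
      where
      go : ∀ {k} x → value o i ≡ x → smap (old j) x ≡ minus k → 1 ≤ label o i
      go (minus _) eq _ = negative eq

    side : ∀ i → (punchIn j i Fin.< j × label o i ℕ.< threshold ℓ) ⊎ (j Fin.< punchIn j i × threshold ℓ ≤ label o i)
    side i with ℕP.<-cmp (Fin.toℕ (punchIn j i)) (Fin.toℕ j)
    ... | tri< lt _ _ = inj₁ (lt , below i lt)
    ... | tri≈ _ eq _ = contradiction (FinP.toℕ-injective eq) (FinP.punchInᵢ≢i j i)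
    ... | tri> _ _ gt = inj₂ (gt , above i gt)

    -- When the labels tie, the partners decide: maximality bounds the label of the old partner by
    -- `b`, and the cut puts the new partner on the side that keeps π increasing, even between equal
    -- symbols.
    old<top : ∀ i → Lex Fin._<_ (map₂ (smap (old j)) (o i)) (a , mid j <$ ℓ)
    old<top i with maximal i
    ... | inj₁ lt = inj₁ lt
    ... | inj₂ (eq , r) = inj₂ (eq , go (value o i) ℓ side r)
      where
      go : ∀ x ℓ → (∀ i → (punchIn j i Fin.< j × label o i ℕ.< threshold ℓ) ⊎ (j Fin.< punchIn j i × threshold ℓ ≤ label o i)) →
           SignedRel ℕ._≤_ (smap (label o) x) ℓ → SignedRel Fin._<_ (smap (old j) x) (mid j <$ ℓ)
      go (minus p) (minus b) side (minus b≤fp) with side p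
      ... | inj₁ (_ , fp<b) = contradiction b≤fp (ℕP.<⇒≱ fp<b)
      ... | inj₂ (gt , _)   = minus (punchIn-mono-< top gt)
      go (minus p) (plus b) side minus-plus = minus-plus
      go (plus p) (plus b) side (plus fp≤b) with side p
      ... | inj₁ (lt , _)   = plus (punchIn-mono-< top lt)
      ... | inj₂ (_ , b<fp) = contradiction fp≤b (ℕP.<⇒≱ b<fp)

    mid<ᴷtop : ∀ {ℓ} → Canonical (a , ℓ) → Lex Fin._<_ (∣ ℓ ∣ , top <$ ℓ) (a , mid j <$ ℓ)
    mid<ᴷtop (plus b<a) = inj₁ b<a
    mid<ᴷtop (minus 1≤b b≤a) with ℕP.m≤n⇒m<n∨m≡n b≤a
    ... | inj₁ b<a = inj₁ b<a
    ... | inj₂ b≡a = inj₂ (b≡a , minus (mid<top j))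

    -- A label below the threshold can equal `b` only for a positive arc, whose end has value
    -- `plus top`, the largest possible. Dually, in `above⇒` a tie meets `minus top`, the smallest.
    below⇒ : ∀ ℓ k x → k ℕ.< threshold ℓ → Lex Fin._<_ (k , smap (old j) x) (∣ ℓ ∣ , top <$ ℓ)
    below⇒ (minus b) k x k<b = inj₁ k<b
    below⇒ (plus b) k x (s≤s k≤b) with ℕP.m≤n⇒m<n∨m≡n k≤b
    ... | inj₁ k<b = inj₁ k<b
    ... | inj₂ k≡b = inj₂ (k≡b , go x)
      where
      go : ∀ x → SignedRel Fin._<_ (smap (old j) x) (plus top)
      go (minus p) = minus-plus
      go (plus p) = plus (old<top′ p)
        where
        old<top′ : ∀ p → old j p Fin.< top
        old<top′ p = mid<top (punchIn j p)

    above⇒ : ∀ ℓ k x → threshold ℓ ≤ k → Lex Fin._<_ (∣ ℓ ∣ , top <$ ℓ) (k , smap (old j) x)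
    above⇒ (plus b) k x b<k = inj₁ b<k
    above⇒ (minus b) k x b≤k with ℕP.m≤n⇒m<n∨m≡n b≤k
    ... | inj₁ b<k = inj₁ b<k
    ... | inj₂ b≡k = inj₂ (b≡k , go x)
      where
      go : ∀ x → SignedRel Fin._<_ (minus top) (smap (old j) x)
      go (minus p) = minus (mid<top (punchIn j p))
      go (plus p) = minus-plus

    increasing⁺ : ∀ u v → u Fin.< v → Lex Fin._<_ (o⁺ u) (o⁺ v)
    increasing⁺ u v u<v with view j u | view j v
    ... | isTop   | _ = contradiction u<v (top≮ v)
    ... | isMid   | isTop = subst₂ (Lex Fin._<_) (sym (insert-mid j a ℓ o)) (sym (insert-top j a ℓ o)) (mid<ᴷtop canonical)
    ... | isMid   | isMid = contradiction u<v (ℕP.<-irrefl refl)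
    ... | isMid   | isOld i = subst₂ (Lex Fin._<_) (sym (insert-mid j a ℓ o)) (sym (insert-old j a ℓ o i))
                                (above⇒ ℓ (label o i) (value o i) (above i (punchIn-cancel-< top u<v)))
    ... | isOld i | isTop = subst₂ (Lex Fin._<_) (sym (insert-old j a ℓ o i)) (sym (insert-top j a ℓ o)) (old<top i)
    ... | isOld i | isMid = subst₂ (Lex Fin._<_) (sym (insert-old j a ℓ o i)) (sym (insert-mid j a ℓ o))
                                (below⇒ ℓ (label o i) (value o i) (below i (punchIn-cancel-< top u<v)))
    ... | isOld i | isOld i′ = subst₂ (Lex Fin._<_) (sym (insert-old j a ℓ o i)) (sym (insert-old j a ℓ o i′))
                                (lex-map (old-mono j) (increasing i i′ (old-cancel j u<v)))

  insert-valid : Valid o⁺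
  insert-valid = record
    { involutive = involutive⁺ ; fixedPointFree = fixedPointFree⁺ ; increasing = increasing⁺ ; negative = λ {u} → negative⁺ {u} }

  insert-maximal : ∀ u → symbol o⁺ u ≼ (a , ℓ)
  insert-maximal u with view j u
  ... | isTop   = subst (_≼ (a , ℓ)) (sym (symbol-insert-top j a ℓ o)) ≼-refl
  ... | isMid   = subst (_≼ (a , ℓ)) (sym (symbol-insert-mid j a ℓ o)) (transpose≼ canonical)
  ... | isOld i = subst (_≼ (a , ℓ)) (sym (symbol-insert-old j a ℓ o i)) (maximal i)

-- Removing the last arc

module Removal {m : ℕ} (o : Labelled (2 ℕ.+ m)) (valid : Valid o) where
  open Valid valid

  private
    g = value o top

    top≢partner : top ≢ ∣ g ∣
    top≢partner = fixedPointFree top ∘ sym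

  j : Fin (suc m)
  j = punchOut top≢partner

  private
    mid≡partner : mid j ≡ ∣ g ∣
    mid≡partner = FinP.punchIn-punchOut top≢partner

    value-top : value o top ≡ mid j <$ g
    value-top = trans (sym (<$-∣∣ g)) (cong (_<$ g) (sym mid≡partner))

    value-mid : value o (mid j) ≡ top <$ g
    value-mid = trans (cong (value o) mid≡partner) (involutive top)

    -- By involutivity no other position is paired with an end of the last arc, so the remaining
    -- partners are old positions.
    value-old : ∀ i → ∃ λ p → value o (old j i) ≡ smap (old j) p
    value-old i = go (view j ∣ v ∣) refl
      where
      v = value o (old j i)
      go : ∀ {u} → View j u → ∣ v ∣ ≡ u → ∃ λ p → v ≡ smap (old j) p
      go isTop eq = contradiction
        (trans mid≡partner (trans (cong ∣_∣ (trans (cong (value o) (sym eq)) (involutive (old j i)))) (∣∣-<$ v)))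
        (mid≢old j)
      go isMid eq = contradiction
        (trans (sym (∣∣-<$ v)) (trans (cong ∣_∣ (trans (sym (involutive (old j i))) (trans (cong (value o) eq) value-mid))) (∣∣-<$ g)))
        (FinP.punchInᵢ≢i top _)
      go (isOld p) eq = p <$ v , trans (sym (<$-∣∣ v)) (trans (cong (_<$ v) eq) (sym (smap-∘ (old j) (λ _ → p) v)))

  remove : Labelled m
  remove i = label o (old j i) , proj₁ (value-old i)

  private
    x = symbol o top
    ℓ = proj₂ x

    old-restore : ∀ i → o (old j i) ≡ map₂ (smap (old j)) (remove i)
    old-restore i = cong (label o (old j i) ,_) (proj₂ (value-old i))

    mid-restore : o (mid j) ≡ (∣ ℓ ∣ , top <$ g)
    mid-restore = cong₂ _,_ (trans (cong (label o) mid≡partner) (sym (∣∣-smap (label o) g))) value-mid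

  symbol-remove : ∀ i → symbol remove i ≡ symbol o (old j i)
  symbol-remove i = cong (label o (old j i) ,_)
    (trans (sym (smap-∘ (label o) (old j) (value remove i))) (cong (smap (label o)) (sym (proj₂ (value-old i)))))

  remove-valid : Valid remove
  remove-valid = record
    { involutive = λ i → smap-injective (old-injective j) (begin
        smap (old j) (value remove ∣ value remove i ∣)   ≡⟨ proj₂ (value-old ∣ value remove i ∣) ⟨
        value o (old j ∣ value remove i ∣)               ≡⟨ cong (value o) (∣∣-old i) ⟨
        value o ∣ value o (old j i) ∣                    ≡⟨ involutive (old j i) ⟩
        old j i <$ value o (old j i)                     ≡⟨ cong (old j i <$_) (proj₂ (value-old i)) ⟩
        old j i <$ smap (old j) (value remove i)         ≡⟨ smap-∘ (λ _ → old j i) (old j) (value remove i) ⟩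
        old j i <$ value remove i                        ≡⟨ smap-∘ (old j) (λ _ → i) (value remove i) ⟨
        smap (old j) (i <$ value remove i)               ∎)
    ; fixedPointFree = λ i eq → fixedPointFree (old j i) (trans (∣∣-old i) (cong (old j) eq))
    ; increasing = λ i i′ i<i′ → cancel (subst₂ (Lex Fin._<_) (old-restore i) (old-restore i′) (increasing (old j i) (old j i′) (old-mono j i<i′)))
    ; negative = λ {i} eq → negative (trans (proj₂ (value-old i)) (cong (smap (old j)) eq))
    }
    where
    open ≡-Reasoning
    ∣∣-old : ∀ i → ∣ value o (old j i) ∣ ≡ old j ∣ value remove i ∣
    ∣∣-old i = trans (cong ∣_∣ (proj₂ (value-old i))) (∣∣-smap (old j) (value remove i))
    cancel : ∀ {k k′} → Lex Fin._<_ (map₂ (smap (old j)) k) (map₂ (smap (old j)) k′) → Lex Fin._<_ k k′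
    cancel         (inj₁ lt)       = inj₁ lt
    cancel {k} {k′} (inj₂ (eq , r)) = inj₂ (eq , signedRel-unmap (old-cancel j) (proj₂ k) (proj₂ k′) r)

  -- `increasing` compares the two ends of the last arc. A positive arc with equal labels would need
  -- `top` to lie below its partner. A negative arc may have equal labels, and `negative` keeps its
  -- partner's label off 0.
  canonical : Canonical x
  canonical = go g refl
    (subst₂ (Lex Fin._<_) (cong (label o (mid j) ,_) value-mid) (cong (label o top ,_) value-top) (increasing (mid j) top (mid<top j)))
    where
    go : ∀ h → g ≡ h → Lex Fin._<_ (label o (mid j) , top <$ h) (label o top , mid j <$ h) → Canonical (label o top , smap (label o) h)
    go (plus p) eq lex = plus (subst (λ q → label o q ℕ.< label o top) (trans mid≡partner (cong ∣_∣ eq))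
      (lex-resolve lex (λ { (plus top<) → top≮ _ top< })))
    go (minus p) eq lex = minus (subst (λ q → 1 ≤ label o q) mid≡p (negative (trans value-mid (cong (top <$_) eq))))
                            (subst (λ q → label o q ≤ label o top) mid≡p (lex⇒≤ lex))
      where
      mid≡p : mid j ≡ p
      mid≡p = trans mid≡partner (cong ∣_∣ eq)

  private
    -- No value lies below `minus top` or above `plus top`, so positions sharing the partner's label
    -- all follow it for a negative arc and all precede it for a positive one, as `threshold`
    -- prescribes.
    isCut : IsCut (label remove) (threshold ℓ) j
    isCut = record
      { below = λ i lt → before g (subst (Lex Fin._<_ (o (old j i))) mid-restore (increasing (old j i) (mid j) (punchIn-mono-< top lt)))
      ; above = λ i lt → after g (subst (λ k → Lex Fin._<_ k (o (old j i))) mid-restore (increasing (mid j) (old j i) (punchIn-mono-< top lt)))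
      }
      where
      before : ∀ h {k v} → Lex Fin._<_ (k , v) (∣ smap (label o) h ∣ , top <$ h) → k ℕ.< threshold (smap (label o) h)
      before (minus p) lex = lex-resolve lex (λ { (minus top<) → top≮ _ top< })
      before (plus p) lex = s≤s (lex⇒≤ lex)
      after : ∀ h {k v} → Lex Fin._<_ (∣ smap (label o) h ∣ , top <$ h) (k , v) → threshold (smap (label o) h) ≤ k
      after (minus p) lex = lex⇒≤ lex
      after (plus p) lex = lex-resolve lex (λ { (plus top<) → top≮ _ top< })

    insertAtCut-remove : ∀ u → insertAtCut j x remove u ≡ o u
    insertAtCut-remove u with view j u
    ... | isTop   = trans (insert-top j _ ℓ remove) (cong (label o top ,_) (trans (smap-∘ (λ _ → mid j) (label o) g) (sym value-top)))
    ... | isMid   = trans (insert-mid j _ ℓ remove) (trans (cong (∣ ℓ ∣ ,_) (smap-∘ (λ _ → top) (label o) g)) (sym mid-restore))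
    ... | isOld i = trans (insert-old j _ ℓ remove i) (sym (old-restore i))

  insert-remove : ∀ u → insert x remove u ≡ o u
  insert-remove u = trans (cong (λ j → insertAtCut j x remove u) (isCut-unique (label remove) (threshold ℓ) cutIsCut isCut)) (insertAtCut-remove u)
    where cutIsCut = cut-isCut (label remove) (threshold ℓ) (Valid.label-mono remove-valid)

-- Labelled involutions are functions compared pointwise, so even `cut` has to be shown to respect
-- pointwise equality.
insert-cong : ∀ {m} x {o o′ : Labelled m} → (∀ i → o i ≡ o′ i) → ∀ u → insert x o u ≡ insert x o′ u
insert-cong x@(a , ℓ) {o} {o′} o≡o′ u = trans (cong (λ j → insertAtCut j x o u) (cut-cong (threshold ℓ) (cong proj₁ ∘ o≡o′)))
  (go (cut (label o′) (threshold ℓ)) (view _ u))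
  where
  cut-cong : ∀ {m} {f f′ : Fin m → ℕ} t → (∀ i → f i ≡ f′ i) → cut f t ≡ cut f′ t
  cut-cong {zero}  t eq = refl
  cut-cong {suc m} {f} {f′} t eq with f zero ℕ.<? t | f′ zero ℕ.<? t
  ... | yes _ | yes _ = cong suc (cut-cong t (eq ∘ suc))
  ... | no  _ | no  _ = refl
  ... | yes p | no ¬p = contradiction (subst (ℕ._< t) (eq zero) p) ¬p
  ... | no ¬p | yes p = contradiction (subst (ℕ._< t) (sym (eq zero)) p) ¬p
  go : ∀ j {u} → View j u → insertAtCut j x o u ≡ insertAtCut j x o′ u
  go j isTop     = trans (insert-top j a ℓ o) (sym (insert-top j a ℓ o′))
  go j isMid     = trans (insert-mid j a ℓ o) (sym (insert-mid j a ℓ o′))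
  go j (isOld i) = trans (insert-old j a ℓ o i) (trans (cong (map₂ (smap (old j))) (o≡o′ i)) (sym (insert-old j a ℓ o′ i)))

-- The result reveals its ingredients: `top` has symbol `x`, its partner gives the cut, and the old
-- positions carry `o`.
insert-injective : ∀ {m} x x′ (o o′ : Labelled m) → (∀ u → insert x o u ≡ insert x′ o′ u) → x ≡ x′ × (∀ i → o i ≡ o′ i)
insert-injective x@(a , ℓ) x′@(a′ , ℓ′) o o′ eq = x≡x′ , o≡o′
  where
  j  = cut (label o) (threshold ℓ)
  j′ = cut (label o′) (threshold ℓ′)

  symbol-cong : ∀ {m} {o o′ : Labelled m} → (∀ u → o u ≡ o′ u) → ∀ u → symbol o u ≡ symbol o′ u
  symbol-cong {o = o} {o′} eq u = cong₂ _,_ (cong proj₁ (eq u))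
    (trans (cong (smap (label o)) (cong proj₂ (eq u))) (smap-cong (cong proj₁ ∘ eq) (value o′ u)))

  x≡x′ : x ≡ x′
  x≡x′ = trans (sym (symbol-insert-top j a ℓ o)) (trans (symbol-cong eq top) (symbol-insert-top j′ a′ ℓ′ o′))

  j≡j′ : j ≡ j′
  j≡j′ = FinP.punchIn-injective top _ _ (trans (sym (∣∣-<$ ℓ)) (trans (cong (∣_∣ ∘ proj₂)
    (trans (sym (insert-top j a ℓ o)) (trans (eq top) (insert-top j′ a′ ℓ′ o′)))) (∣∣-<$ ℓ′)))

  o≡o′ : ∀ i → o i ≡ o′ i
  o≡o′ i = cong₂ _,_ (cong proj₁ same) (smap-injective (old-injective j) (cong proj₂ same))
    where
    same : map₂ (smap (old j)) (o i) ≡ map₂ (smap (old j)) (o′ i)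
    same = trans (sym (insert-old j a ℓ o i)) (trans (eq (old j i)) (trans (cong (λ k → insert x′ o′ (old k i)) j≡j′)
      (trans (insert-old j′ a′ ℓ′ o′ i) (cong (λ k → map₂ (smap (old k)) (o′ i)) (sym j≡j′)))))

-- The bijection with multisets of symbols

multisets : ∀ {A : Set} → List A → ∀ n → List (Vec A n)
multisets S       zero    = [] ∷ []
multisets []      (suc n) = []
multisets (x ∷ S) (suc n) = multisets S (suc n) ++ map (x ∷_) (multisets (x ∷ S) n)

length-multisets : ∀ {A : Set} (S : List A) n → length (multisets S n) ≡ multichoose (length S) n
length-multisets S       zero    = refl
length-multisets []      (suc n) = refl
length-multisets (x ∷ S) (suc n) = trans (ListP.length-++ (multisets S (suc n)))
  (cong₂ ℕ._+_ (length-multisets S (suc n))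
    (trans (ListP.length-map (x ∷_) (multisets (x ∷ S) n)) (length-multisets (x ∷ S) n)))

head-∈ : ∀ {A : Set} (S : List A) {n x} {w : Vec A n} → x ∷ w ∈ multisets S (suc n) → x ∈ S
head-∈ (y ∷ S) x∷w∈ with ∈-++⁻ (multisets S _) x∷w∈
... | inj₁ ∈S = there (head-∈ S ∈S)
... | inj₂ ∈map with ∈-map⁻ (y ∷_) ∈map
...   | _ , _ , refl = here refl

multisets-unique : ∀ {A : Set} {S : List A} → Unique S → ∀ n → Unique (multisets S n)
multisets-unique u zero = [] ∷ []
multisets-unique [] (suc n) = []
multisets-unique {S = x ∷ S} u@(x∉S ∷ uS) (suc n) =
  UniqueP.++⁺ (multisets-unique uS (suc n)) (UniqueP.map⁺ VecP.∷-injectiveʳ (multisets-unique u n)) disjoint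
  where
  disjoint : Disjoint (multisets S (suc n)) (map (x ∷_) (multisets (x ∷ S) n))
  disjoint (∈S , ∈map) with ∈-map⁻ (x ∷_) ∈map
  ... | _ , _ , refl = All.lookup x∉S (head-∈ S ∈S) refl

-- Unlike `2 ℕ.* n`, this reduces at `suc n` to the index `2 ℕ.+ double n` produced by `insert`.
double : ℕ → ℕ
double zero    = zero
double (suc n) = 2 ℕ.+ double n

-- In a multiset drawn from a descending list the head is the largest symbol; it is inserted last,
-- as the maximality in `insert-valid` demands.
assemble : ∀ {n} → Vec Symbol n → Labelled (double n)
assemble []      = λ ()
assemble (x ∷ w) = insert x (assemble w)

assemble-injective : ∀ {n} (w w′ : Vec Symbol n) → (∀ u → assemble w u ≡ assemble w′ u) → w ≡ w′
assemble-injective []      []        eq = refl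
assemble-injective (x ∷ w) (x′ ∷ w′) eq with insert-injective x x′ (assemble w) (assemble w′) eq
... | x≡x′ , eq′ = cong₂ _∷_ x≡x′ (assemble-injective w w′ eq′)

Descending : List Symbol → Set
Descending = AllPairs (flip _≺_)

-- The bound is stated for every `x` above `S`: it is instantiated at the head before an insertion,
-- and it survives when the head is skipped.
assemble-sound : ∀ {S} → All Canonical S → Descending S → ∀ {n} {w : Vec Symbol n} → w ∈ multisets S n →
  Valid (assemble w) × (∀ x → All (_≼ x) S → ∀ u → symbol (assemble w) u ≼ x)
assemble-sound {S} can desc {zero} {[]} _ =
  record { involutive = λ () ; fixedPointFree = λ () ; increasing = λ () ; negative = λ { {()} } } , λ _ _ ()
assemble-sound {y ∷ S} (cy ∷ can) (y≻S ∷ desc) {suc n} w∈ with ∈-++⁻ (multisets S (suc n)) w∈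
... | inj₁ w∈S = proj₁ ih , λ { x (_ ∷ bound) → proj₂ ih x bound }
  where ih = assemble-sound can desc w∈S
... | inj₂ w∈map with ∈-map⁻ (y ∷_) w∈map
...   | w′ , w′∈ , refl = insert-valid cy (proj₁ ih) maximal ,
        λ { x (y≼x ∷ _) u → ≼-trans (insert-maximal cy (proj₁ ih) maximal u) y≼x }
  where
  ih = assemble-sound (cy ∷ can) (y≻S ∷ desc) w′∈
  maximal = proj₂ ih y (≼-refl ∷ All.map ≺⇒≼ y≻S)

DownClosed : List Symbol → Set
DownClosed S = ∀ {x y} → x ∈ S → Canonical y → y ≼ x → y ∈ S

-- Only canonical symbols must lie in `S`, since the smaller end of an arc may carry a transposed
-- symbol. `DownClosed` recovers this condition once an arc has been removed.
Complete : List Symbol → ℕ → Set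
Complete S n = (o : Labelled (double n)) → Valid o → Descending S → DownClosed S →
  (∀ u → Canonical (symbol o u) → symbol o u ∈ S) →
  ∃ λ w → w ∈ multisets S n × (∀ u → assemble w u ≡ o u)

complete-step : ∀ y S n → Complete (y ∷ S) n → Complete S (suc n) → Complete (y ∷ S) (suc n)
complete-step y S n use skip o valid (y≻S ∷ desc) down sym∈ = go (sym∈ top (Removal.canonical o valid))
  where
  open Removal o valid
  below-top : ∀ u → symbol o u ≼ symbol o top
  below-top u with u Fin.≟ top
  ... | yes refl = ≼-refl
  ... | no u≢top = Valid.symbol-mono valid u top (FinP.≤∧≢⇒< (FinP.≤fromℕ u) u≢top)
  tail : ∀ {x z} → x ∈ S → z ≼ x → z ∈ y ∷ S → z ∈ S
  tail x∈S z≼x (here refl) = contradiction z≼x (≺⇒⋡ (All.lookup y≻S x∈S))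
  tail x∈S z≼x (there z∈S) = z∈S
  go : symbol o top ∈ y ∷ S → ∃ λ w → w ∈ multisets (y ∷ S) (suc n) × (∀ u → assemble w u ≡ o u)
  go (here x≡y) with use remove remove-valid (y≻S ∷ desc) down
    (λ i can → down (here refl) can (subst₂ _≼_ (sym (symbol-remove i)) x≡y (below-top (old j i))))
  ... | w , w∈ , w≡ = y ∷ w , ∈-++⁺ʳ (multisets S (suc n)) (∈-map⁺ (y ∷_) w∈) ,
        λ u → trans (insert-cong y w≡ u) (trans (cong (λ z → insert z remove u) (sym x≡y)) (insert-remove u))
  go (there x∈S) with skip o valid desc
    (λ x∈S′ can z≼x → tail x∈S′ z≼x (down (there x∈S′) can z≼x))
    (λ u can → tail x∈S (below-top u) (sym∈ u can))
  ... | w , w∈ , w≡ = w , ∈-++⁺ˡ w∈ , w≡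

assemble-complete : ∀ S n → Complete S n
assemble-complete S       zero    o valid desc down sym∈ = [] , here refl , λ ()
assemble-complete []      (suc n) o valid desc down sym∈ with sym∈ top (Removal.canonical o valid)
... | ()
assemble-complete (y ∷ S) (suc n) = complete-step y S n (assemble-complete (y ∷ S) n) (assemble-complete S (suc n))

-- The r(r+1) symbols with labels at most r

plusSymbol minusSymbol : ℕ → ℕ → Symbol
plusSymbol r b = suc r , plus b
minusSymbol r b = suc r , minus (suc b)

-- The two runs go in opposite directions because a larger magnitude raises a positive symbol and
-- lowers a negative one; the whole list thus descends.
symbols : ℕ → List Symbol
symbols zero    = []
symbols (suc r) = applyDownFrom (plusSymbol r) (suc r) ++ applyUpTo (minusSymbol r) (suc r) ++ symbols r

length-symbols : ∀ r → length (symbols r) ≡ r ℕ.* suc r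
length-symbols zero    = refl
length-symbols (suc r) = begin
  length (symbols (suc r)) ≡⟨ ListP.length-++ (applyDownFrom (plusSymbol r) (suc r)) ⟩
  length (applyDownFrom (plusSymbol r) (suc r)) ℕ.+ length (applyUpTo (minusSymbol r) (suc r) ++ symbols r)
    ≡⟨ cong₂ ℕ._+_ (ListP.length-applyDownFrom (plusSymbol r) (suc r)) (ListP.length-++ (applyUpTo (minusSymbol r) (suc r))) ⟩
  suc r ℕ.+ (length (applyUpTo (minusSymbol r) (suc r)) ℕ.+ length (symbols r))
    ≡⟨ cong₂ (λ x y → suc r ℕ.+ (x ℕ.+ y)) (ListP.length-applyUpTo (minusSymbol r) (suc r)) (length-symbols r) ⟩
  suc r ℕ.+ (suc r ℕ.+ r ℕ.* suc r) ≡⟨ collect r ⟩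
  suc r ℕ.* suc (suc r) ∎
  where
  open ≡-Reasoning
  collect : ∀ r → suc r ℕ.+ (suc r ℕ.+ r ℕ.* suc r) ≡ suc r ℕ.* suc (suc r)
  collect = ℕR.solve-∀

∈-symbols⁺ : ∀ r {x} → Canonical x → proj₁ x ≤ r → x ∈ symbols r
∈-symbols⁺ zero (minus 1≤b b≤a) a≤0 = contradiction (ℕP.≤-trans 1≤b (ℕP.≤-trans b≤a a≤0)) λ ()
∈-symbols⁺ zero (plus b<a) a≤0 = contradiction (ℕP.≤-trans b<a a≤0) λ ()
∈-symbols⁺ (suc r) can a≤r with ℕP.m≤n⇒m<n∨m≡n a≤r
... | inj₁ (s≤s a≤r′) = ∈-++⁺ʳ (applyDownFrom (plusSymbol r) (suc r)) (∈-++⁺ʳ (applyUpTo (minusSymbol r) (suc r)) (∈-symbols⁺ r can a≤r′))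
∈-symbols⁺ (suc r) (plus b<a) _ | inj₂ refl = ∈-++⁺ˡ (∈-applyDownFrom⁺ (plusSymbol r) b<a)
∈-symbols⁺ (suc r) (minus {b = suc b} _ b≤a) _ | inj₂ refl =
  ∈-++⁺ʳ (applyDownFrom (plusSymbol r) (suc r)) (∈-++⁺ˡ (∈-applyUpTo⁺ (minusSymbol r) b≤a))

symbols-canonical : ∀ r → All (λ x → Canonical x × proj₁ x ≤ r) (symbols r)
symbols-canonical zero    = []
symbols-canonical (suc r) =
  AllP.++⁺ (AllP.applyDownFrom⁺₁ (plusSymbol r) (suc r) (λ b<a → plus b<a , ℕP.≤-refl))
  (AllP.++⁺ (AllP.applyUpTo⁺₁ (minusSymbol r) (suc r) (λ b<a → minus (s≤s z≤n) b<a , ℕP.≤-refl))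
  (All.map (map₂ ℕP.m≤n⇒m≤1+n) (symbols-canonical r)))

symbols-descending : ∀ r → Descending (symbols r)
symbols-descending zero    = []
symbols-descending (suc r) =
  AllPairsP.++⁺ (AllPairsP.applyDownFrom⁺₁ (plusSymbol r) (suc r) (λ b<b′ _ → inj₂ (refl , plus b<b′)))
    (AllPairsP.++⁺ (AllPairsP.applyUpTo⁺₁ (minusSymbol r) (suc r) (λ b<b′ _ → inj₂ (refl , minus (s≤s b<b′))))
      (symbols-descending r)
      (AllP.applyUpTo⁺₁ (minusSymbol r) (suc r) (λ _ → smaller)))
    (AllP.applyDownFrom⁺₁ (plusSymbol r) (suc r) (λ _ →
      AllP.++⁺ (AllP.applyUpTo⁺₁ (minusSymbol r) (suc r) (λ _ → inj₂ (refl , minus-plus))) smaller))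
  where
  smaller : ∀ {ℓ} → All (_≺ (suc r , ℓ)) (symbols r)
  smaller = All.map (λ p → inj₁ (s≤s (proj₂ p))) (symbols-canonical r)

symbols-unique : ∀ r → Unique (symbols r)
symbols-unique r = AllPairs.map (λ { y≺x refl → ≺⇒⋡ y≺x ≼-refl }) (symbols-descending r)

symbols-downClosed : ∀ r → DownClosed (symbols r)
symbols-downClosed r x∈ can y≼x =
  ∈-symbols⁺ r can (ℕP.≤-trans (lex⇒≤ y≼x) (proj₂ (All.lookup (symbols-canonical r) x∈)))

-- Duplicate-free enumerations

module _ {A B C : Set} (f : A → B → C) (g : A → List B) where
  -- `words`, `signedLetters` and `labelledInvolutions` all have this shape definitionally, so
  -- membership and uniqueness are proved once.
  fibres : List A → List C
  fibres = concatMap (λ x → map (f x) (g x))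

  ∈-fibres⁺ : ∀ {xs x y} → x ∈ xs → y ∈ g x → f x y ∈ fibres xs
  ∈-fibres⁺ {x ∷ xs} (here refl) y∈ = ∈-++⁺ˡ (∈-map⁺ (f x) y∈)
  ∈-fibres⁺ {x ∷ xs} (there x∈)  y∈ = ∈-++⁺ʳ (map (f x) (g x)) (∈-fibres⁺ x∈ y∈)

  ∈-fibres⁻ : ∀ xs {z} → z ∈ fibres xs → ∃₂ λ x y → x ∈ xs × y ∈ g x × z ≡ f x y
  ∈-fibres⁻ (x ∷ xs) z∈ with ∈-++⁻ (map (f x) (g x)) z∈
  ... | inj₂ z∈xs with ∈-fibres⁻ xs z∈xs
  ...   | x′ , y , x′∈ , y∈ , eq = x′ , y , there x′∈ , y∈ , eq
  ∈-fibres⁻ (x ∷ xs) z∈ | inj₁ z∈x with ∈-map⁻ (f x) z∈x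
  ...   | y , y∈ , eq = x , y , here refl , y∈ , eq

  fibres-unique : (∀ {x x′ y y′} → f x y ≡ f x′ y′ → x ≡ x′ × y ≡ y′) → (∀ x → Unique (g x)) →
                  ∀ {xs} → Unique xs → Unique (fibres xs)
  fibres-unique inj ug []                        = []
  fibres-unique inj ug {x ∷ xs} (x∉xs ∷ uxs) =
    UniqueP.++⁺ (UniqueP.map⁺ (proj₂ ∘ inj) (ug x)) (fibres-unique inj ug uxs) disjoint
    where
    disjoint : Disjoint (map (f x) (g x)) (fibres xs)
    disjoint (z∈x , z∈xs) with ∈-map⁻ (f x) z∈x | ∈-fibres⁻ xs z∈xs
    ... | _ , _ , refl | _ , _ , x′∈ , _ , eq = All.lookup x∉xs x′∈ (proj₁ (inj eq))

words-unique : ∀ {L} → Unique L → ∀ n → Unique (words L n)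
words-unique uL zero    = [] ∷ []
words-unique uL (suc n) = fibres-unique _∷_ (λ _ → words _ n) VecP.∷-injective (λ _ → words-unique uL n) uL

∈-words⁺ : ∀ {L n} (v : Vec ℤ n) → (∀ i → lookup v i ∈ L) → v ∈ words L n
∈-words⁺ []      _  = here refl
∈-words⁺ (x ∷ v) x∈ = ∈-fibres⁺ _∷_ (λ _ → words _ _) (x∈ zero) (∈-words⁺ v (x∈ ∘ suc))

private
  signed : ℕ → Bool → ℤ
  signed j true  = + suc j
  signed j false = -[1+ j ]

  signed-injective : ∀ {j j′ s s′} → signed j s ≡ signed j′ s′ → j ≡ j′ × s ≡ s′
  signed-injective {s = true}  {true}  refl = refl , refl
  signed-injective {s = false} {false} refl = refl , refl

  signs : List Bool
  signs = true ∷ false ∷ []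

signedLetters-unique : ∀ m → Unique (signedLetters m)
signedLetters-unique m =
  fibres-unique signed (λ _ → signs) signed-injective (λ _ → ((λ ()) ∷ []) ∷ [] ∷ []) (UniqueP.upTo⁺ m)

-- Signed positions as integers

toℤ : ∀ {m} → Signed (Fin m) → ℤ
toℤ (minus i) = -[1+ toℕ i ]
toℤ (plus i) = + suc (toℕ i)

toℤ-∈ : ∀ {m} (x : Signed (Fin m)) → toℤ x ∈ signedLetters m
toℤ-∈ (minus i) = ∈-fibres⁺ signed (λ _ → signs) {y = false} (∈-upTo⁺ (FinP.toℕ<n i)) (there (here refl))
toℤ-∈ (plus i) = ∈-fibres⁺ signed (λ _ → signs) {y = true} (∈-upTo⁺ (FinP.toℕ<n i)) (here refl)

∣toℤ∣ : ∀ {m} (x : Signed (Fin m)) → ℤ.∣ toℤ x ∣ ≡ pos ∣ x ∣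
∣toℤ∣ (minus i) = refl
∣toℤ∣ (plus i) = refl

toℤ-injective : ∀ {m} {x y : Signed (Fin m)} → toℤ x ≡ toℤ y → x ≡ y
toℤ-injective {x = minus i} {minus j} eq = cong minus (FinP.toℕ-injective (ℤP.-[1+-injective eq))
toℤ-injective {x = plus i} {plus j} eq = cong plus (FinP.toℕ-injective (ℕP.suc-injective (ℤP.+-injective eq)))

toℤ-surjective : ∀ {m} z → 1 ≤ ℤ.∣ z ∣ → ℤ.∣ z ∣ ≤ m → ∃ λ (x : Signed (Fin m)) → toℤ x ≡ z
toℤ-surjective (+ suc k)  _ k<m = plus (Fin.fromℕ< k<m) , cong (+_ ∘ suc) (FinP.toℕ-fromℕ< k<m)
toℤ-surjective -[1+ k ]   _ k<m = minus (Fin.fromℕ< k<m) , cong -[1+_] (FinP.toℕ-fromℕ< k<m)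

toℤ-mono : ∀ {m} {x y : Signed (Fin m)} → SignedRel Fin._<_ x y → toℤ x ℤ.≤ toℤ y
toℤ-mono (minus j<i) = ℤ.-≤- (ℕP.<⇒≤ j<i)
toℤ-mono minus-plus   = ℤ.-≤+
toℤ-mono (plus i<j) = ℤ.+≤+ (s≤s (ℕP.<⇒≤ i<j))

toℤ-cancel : ∀ {m} {x y : Signed (Fin m)} → x ≢ y → toℤ x ℤ.≤ toℤ y → SignedRel Fin._<_ x y
toℤ-cancel {x = minus i} {minus j} x≢y (ℤ.-≤- j≤i) = minus (FinP.≤∧≢⇒< j≤i (x≢y ∘ sym ∘ cong minus))
toℤ-cancel {x = minus i} {plus j} x≢y _ = minus-plus
toℤ-cancel {x = plus i} {plus j} x≢y (ℤ.+≤+ (s≤s i≤j)) = plus (FinP.≤∧≢⇒< i≤j (x≢y ∘ cong plus))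

-- Labellings compatible with a word

infix 4 _⊑_
_⊑_ : ℕ × ℤ → ℕ × ℤ → Set
(l , x) ⊑ (l′ , y) = l ℕ.< l′ ⊎ (l ≡ l′ × x ℤ.≤ y)

⊑-trans : ∀ {k k′ k″} → k ⊑ k′ → k′ ⊑ k″ → k ⊑ k″
⊑-trans (inj₁ p)          (inj₁ q)          = inj₁ (ℕP.<-trans p q)
⊑-trans (inj₁ p)          (inj₂ (refl , _)) = inj₁ p
⊑-trans (inj₂ (refl , _)) (inj₁ q)          = inj₁ q
⊑-trans (inj₂ (refl , r)) (inj₂ (refl , s)) = inj₂ (refl , ℤP.≤-trans r s)

-- The index of type `ℕ × ℤ` is the label and letter preceding the word. Starting at `(0 , + 0)`
-- encodes π₀ = 0 with label 0, which forces a positive first label when π₁ < 0.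
data Compatible (hi : ℕ) : ℕ × ℤ → ∀ {m} → Vec ℤ m → Vec ℕ m → Set where
  []  : ∀ {k} → Compatible hi k [] []
  _∷_ : ∀ {k y l m} {ys : Vec ℤ m} {f} → k ⊑ (l , y) × l ℕ.< hi → Compatible hi (l , y) ys f → Compatible hi k (y ∷ ys) (l ∷ f)

compatible-head : ∀ {hi k m} {ys : Vec ℤ m} {f} → Compatible hi k ys f → ∀ i → k ⊑ (lookup f i , lookup ys i)
compatible-head ((k⊑ , _) ∷ c) zero    = k⊑
compatible-head ((k⊑ , _) ∷ c) (suc i) = ⊑-trans k⊑ (compatible-head c i)

compatible-bound : ∀ {hi k m} {ys : Vec ℤ m} {f} → Compatible hi k ys f → ∀ i → lookup f i ℕ.< hi
compatible-bound ((_ , l<hi) ∷ c) zero    = l<hi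
compatible-bound (_ ∷ c)          (suc i) = compatible-bound c i

compatible-increasing : ∀ {hi k m} {ys : Vec ℤ m} {f} → Compatible hi k ys f →
  ∀ {i j} → i Fin.< j → (lookup f i , lookup ys i) ⊑ (lookup f j , lookup ys j)
compatible-increasing (_ ∷ c) {zero}  {suc j} _         = compatible-head c j
compatible-increasing (_ ∷ c) {suc i} {suc j} (s≤s i<j) = compatible-increasing c i<j

compatible : ∀ {hi k m} (ys : Vec ℤ m) f → (∀ i → k ⊑ (lookup f i , lookup ys i)) → (∀ i → lookup f i ℕ.< hi) →
  (∀ i j → i Fin.< j → (lookup f i , lookup ys i) ⊑ (lookup f j , lookup ys j)) → Compatible hi k ys f
compatible []       []      _    _     _   = []
compatible (y ∷ ys) (l ∷ f) head bound inc =
  (head zero , bound zero) ∷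
  compatible ys f (λ i → inc zero (suc i) (s≤s z≤n)) (bound ∘ suc) (λ i j i<j → inc (suc i) (suc j) (s≤s i<j))

-- After the label is raised, y is compared with itself, which lifts the descent restriction.
labellings : ℕ → ℕ → ℤ → ∀ {m} → Vec ℤ m → List (Vec ℕ m)
labellings lo q       x []       = [] ∷ []
labellings lo zero    x (y ∷ ys) = []
labellings lo (suc q) x (y ∷ ys) with y ℤ.<? x
... | yes _ = labellings (suc lo) q y (y ∷ ys)
... | no  _ = labellings (suc lo) q y (y ∷ ys) ++ map (lo ∷_) (labellings lo (suc q) y ys)

module _ {hi lo : ℕ} {y : ℤ} {l m : ℕ} {ys : Vec ℤ m} {f : Vec ℕ m} where
  compatible-raise : ∀ {x} → lo ℕ.< l → Compatible hi (lo , x) (y ∷ ys) (l ∷ f) → Compatible hi (suc lo , y) (y ∷ ys) (l ∷ f)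
  compatible-raise lo<l ((_ , l<hi) ∷ c) = (Sum.map₂ (_, ℤP.≤-refl) (ℕP.m≤n⇒m<n∨m≡n lo<l) , l<hi) ∷ c

  compatible-raised : Compatible hi (suc lo , y) (y ∷ ys) (l ∷ f) → lo ℕ.< l
  compatible-raised ((inj₁ lo<l , _) ∷ _)       = ℕP.<-trans ℕP.≤-refl lo<l
  compatible-raised ((inj₂ (refl , _) , _) ∷ _) = ℕP.≤-refl

  compatible-lower : ∀ {x} → Compatible hi (suc lo , y) (y ∷ ys) (l ∷ f) → Compatible hi (lo , x) (y ∷ ys) (l ∷ f)
  compatible-lower raised@((_ , l<hi) ∷ c) = (inj₁ (compatible-raised raised) , l<hi) ∷ c

∈-labellings⁻ : ∀ lo q x {hi m} {ys : Vec ℤ m} {f} → lo ℕ.+ q ≡ hi → f ∈ labellings lo q x ys → Compatible hi (lo , x) ys f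
∈-labellings⁻ lo q x {ys = []} {[]} eq f∈ = []
∈-labellings⁻ lo (suc q) x {ys = y ∷ ys} {l ∷ f} eq f∈ with y ℤ.<? x
... | yes _ = compatible-lower (∈-labellings⁻ (suc lo) q y (trans (sym (ℕP.+-suc lo q)) eq) f∈)
... | no y≮x with ∈-++⁻ (labellings (suc lo) q y (y ∷ ys)) f∈
...   | inj₁ f∈′ = compatible-lower (∈-labellings⁻ (suc lo) q y (trans (sym (ℕP.+-suc lo q)) eq) f∈′)
...   | inj₂ f∈′ with ∈-map⁻ (lo ∷_) f∈′
...     | f′ , f′∈ , refl =
  (inj₂ (refl , ℤP.≮⇒≥ y≮x) , subst (lo ℕ.<_) eq (ℕP.m<m+n lo (s≤s z≤n))) ∷ ∈-labellings⁻ lo (suc q) y eq f′∈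

∈-labellings⁺ : ∀ lo q x {hi m} {ys : Vec ℤ m} {f} → lo ℕ.+ q ≡ hi → Compatible hi (lo , x) ys f → f ∈ labellings lo q x ys
∈-labellings⁺ lo q x eq [] = here refl
∈-labellings⁺ lo zero x eq ((k⊑ , l<hi) ∷ c) =
  contradiction (ℕP.<-≤-trans l<hi (ℕP.≤-reflexive (trans (sym eq) (ℕP.+-identityʳ lo)))) (ℕP.≤⇒≯ (lo≤ k⊑))
  where
  lo≤ : ∀ {l y} → (lo , x) ⊑ (l , y) → lo ≤ l
  lo≤ (inj₁ lt)         = ℕP.<⇒≤ lt
  lo≤ (inj₂ (refl , _)) = ℕP.≤-refl
∈-labellings⁺ lo (suc q) x {ys = y ∷ ys} {l ∷ f} eq c@((inj₁ lo<l , _) ∷ _) with y ℤ.<? x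
... | yes _ = ∈-labellings⁺ (suc lo) q y (trans (sym (ℕP.+-suc lo q)) eq) (compatible-raise lo<l c)
... | no  _ = ∈-++⁺ˡ (∈-labellings⁺ (suc lo) q y (trans (sym (ℕP.+-suc lo q)) eq) (compatible-raise lo<l c))
∈-labellings⁺ lo (suc q) x {ys = y ∷ ys} {l ∷ f} eq ((inj₂ (refl , x≤y) , l<hi) ∷ c) with y ℤ.<? x
... | yes y<x = contradiction x≤y (ℤP.<⇒≱ y<x)
... | no  _   = ∈-++⁺ʳ (labellings (suc lo) q y (y ∷ ys)) (∈-map⁺ (lo ∷_) (∈-labellings⁺ lo (suc q) y eq c))

labellings-unique : ∀ lo q x {m} (ys : Vec ℤ m) → Unique (labellings lo q x ys)
labellings-unique lo q       x []       = [] ∷ []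
labellings-unique lo zero    x (y ∷ ys) = []
labellings-unique lo (suc q) x (y ∷ ys) with y ℤ.<? x
... | yes _ = labellings-unique (suc lo) q y (y ∷ ys)
... | no  _ = UniqueP.++⁺ (labellings-unique (suc lo) q y (y ∷ ys))
                (UniqueP.map⁺ VecP.∷-injectiveʳ (labellings-unique lo (suc q) y ys)) disjoint
  where
  disjoint : Disjoint (labellings (suc lo) q y (y ∷ ys)) (map (lo ∷_) (labellings lo (suc q) y ys))
  disjoint (f∈raised , f∈same) with ∈-map⁻ (lo ∷_) f∈same
  ... | f , _ , refl = ℕP.<-irrefl refl (compatible-raised {f = f} (∈-labellings⁻ (suc lo) q y refl f∈raised))

descents-≤-length : ∀ x {m} (ys : Vec ℤ m) → descentsFrom x (toList ys) ≤ m
descents-≤-length x []       = z≤n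
descents-≤-length x (y ∷ ys) with y ℤ.<? x
... | yes _ = s≤s (descents-≤-length y ys)
... | no  _ = ℕP.m≤n⇒m≤1+n (descents-≤-length y ys)

descents-self : ∀ y ys → descentsFrom y (y ∷ ys) ≡ descentsFrom y ys
descents-self y ys with y ℤ.<? y
... | yes y<y = contradiction y<y (ℤP.<-irrefl refl)
... | no  _   = refl

-- Truncation would break Pascal's rule at `m = 0` with `k > q`, because ((0 , 0)) = 1; the bound
-- `k ≤ m` excludes this and holds for descent numbers.
pascal-∸ : ∀ q k m → k ≤ m → multichoose (q ℕ.∸ k) (suc m) ℕ.+ multichoose (suc q ℕ.∸ k) m ≡ multichoose (suc q ℕ.∸ k) (suc m)
pascal-∸ q k m k≤m with ℕP.≤-<-connex k q
... | inj₁ k≤q rewrite ℕP.+-∸-assoc 1 k≤q = refl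
pascal-∸ q (suc k) (suc m) k≤m | inj₂ q<k rewrite ℕP.m≤n⇒m∸n≡0 q<k | ℕP.m≤n⇒m∸n≡0 (ℕP.<⇒≤ q<k) = refl

-- A descent forces a raise and so costs one label; elsewhere the choice between raising and using
-- the current label is Pascal's rule.
length-labellings : ∀ lo q x {m} (ys : Vec ℤ m) →
  length (labellings lo q x ys) ≡ multichoose (q ℕ.∸ descentsFrom x (toList ys)) m
length-labellings lo q       x []       = refl
length-labellings lo zero    x {suc m} (y ∷ ys) = cong (λ c → multichoose c (suc m)) (sym (ℕP.0∸n≡0 (descentsFrom x (y ∷ toList ys))))
length-labellings lo (suc q) x {suc m} (y ∷ ys) with y ℤ.<? x
... | yes _ = trans (length-labellings (suc lo) q y (y ∷ ys))
                (cong (λ d → multichoose (q ℕ.∸ d) (suc m)) (descents-self y (toList ys)))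
... | no  _ = begin
  length (labellings (suc lo) q y (y ∷ ys) ++ map (lo ∷_) (labellings lo (suc q) y ys))
    ≡⟨ ListP.length-++ (labellings (suc lo) q y (y ∷ ys)) ⟩
  length (labellings (suc lo) q y (y ∷ ys)) ℕ.+ length (map (lo ∷_) (labellings lo (suc q) y ys))
    ≡⟨ cong₂ ℕ._+_ (length-labellings (suc lo) q y (y ∷ ys)) (ListP.length-map (lo ∷_) (labellings lo (suc q) y ys)) ⟩
  multichoose (q ℕ.∸ descentsFrom y (y ∷ toList ys)) (suc m) ℕ.+ length (labellings lo (suc q) y ys)
    ≡⟨ cong₂ (λ d l → multichoose (q ℕ.∸ d) (suc m) ℕ.+ l) (descents-self y (toList ys)) (length-labellings lo (suc q) y ys) ⟩
  multichoose (q ℕ.∸ d) (suc m) ℕ.+ multichoose (suc q ℕ.∸ d) m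
    ≡⟨ pascal-∸ q d m (descents-≤-length y ys) ⟩
  multichoose (suc q ℕ.∸ d) (suc m) ∎
  where
  open ≡-Reasoning
  d = descentsFrom y (toList ys)

-- Labelled involutions as pairs of vectors

FPFInvolution : ∀ m → SignedWord m → Set
FPFInvolution m π = IsSignedPerm π × IsInvolution π × IsFixedPointFree π

fpfInvolution? : ∀ m (π : SignedWord m) → Dec (FPFInvolution m π)
fpfInvolution? m π = isSignedPerm? π ×-dec isInvolution? π ×-dec isFPF? π

record Represents {m} (o : Labelled m) (π : SignedWord m) (f : Vec ℕ m) : Set where
  field
    values : ∀ i → lookup π i ≡ toℤ (value o i)
    labels : ∀ i → lookup f i ≡ label o i

represent-fpf : ∀ {m} {o : Labelled m} {π f} → Represents o π f → Valid o → FPFInvolution m π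
represent-fpf {m} {o} {π} {f} rep valid =
  ((λ i → subst (1 ≤_) (sym (∣lookup∣ i)) (s≤s z≤n) , subst (_≤ m) (sym (∣lookup∣ i)) (FinP.toℕ<n ∣ value o i ∣)) ,
   (λ i j eq → abs-injective (FinP.toℕ-injective (ℕP.suc-injective (trans (sym (∣lookup∣ i)) (trans eq (∣lookup∣ j))))))) ,
  (λ i j → (λ eq → trans (values j) (cong toℤ (swap i (plus j) (toℤ-injective (trans (sym (values i)) eq))))) ,
           (λ eq → trans (values j) (cong toℤ (swap i (minus j) (toℤ-injective (trans (sym (values i)) eq)))))) ,
  (λ i eq → fixedPointFree i (FinP.toℕ-injective (ℕP.suc-injective (trans (sym (∣lookup∣ i)) eq))))
  where
  open Represents rep
  open Valid valid
  ∣lookup∣ : ∀ i → ℤ.∣ lookup π i ∣ ≡ pos ∣ value o i ∣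
  ∣lookup∣ i = trans (cong ℤ.∣_∣ (values i)) (∣toℤ∣ (value o i))
  swap : ∀ i x → value o i ≡ x → value o ∣ x ∣ ≡ i <$ x
  swap i x refl = involutive i
  abs-injective : ∀ {i j} → ∣ value o i ∣ ≡ ∣ value o j ∣ → i ≡ j
  abs-injective {i} {j} eq = begin
    i                               ≡⟨ ∣∣-<$ (value o i) ⟨
    ∣ i <$ value o i ∣            ≡⟨ cong ∣_∣ (involutive i) ⟨
    ∣ value o ∣ value o i ∣ ∣   ≡⟨ cong (∣_∣ ∘ value o) eq ⟩
    ∣ value o ∣ value o j ∣ ∣   ≡⟨ cong ∣_∣ (involutive j) ⟩
    ∣ j <$ value o j ∣            ≡⟨ ∣∣-<$ (value o j) ⟩
    j                               ∎
    where open ≡-Reasoning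

represent-compatible : ∀ {m hi} {o : Labelled m} {π f} → Represents o π f → Valid o → (∀ i → label o i ℕ.< hi) →
  Compatible hi (0 , + 0) π f
represent-compatible {m} {hi} {o} {π} {f} rep valid bound = compatible π f
  (λ i → subst₂ (λ l x → (0 , + 0) ⊑ (l , x)) (sym (labels i)) (sym (values i)) (head i (value o i) refl))
  (λ i → subst (ℕ._< hi) (sym (labels i)) (bound i))
  (λ i j i<j → subst₂ _⊑_ (sym (cong₂ _,_ (labels i) (values i))) (sym (cong₂ _,_ (labels j) (values j)))
                 (Sum.map₂ (map₂ toℤ-mono) (increasing i j i<j)))
  where
  open Represents rep
  open Valid valid
  head : ∀ i x → value o i ≡ x → (0 , + 0) ⊑ (label o i , toℤ x)
  head i (minus _) eq = inj₁ (negative eq)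
  head i (plus _) eq with label o i
  ... | zero  = inj₂ (refl , ℤ.+≤+ z≤n)
  ... | suc _ = inj₁ (s≤s z≤n)

represented : ∀ {m hi} {π : SignedWord m} {f} → FPFInvolution m π → Compatible hi (0 , + 0) π f →
  ∃ λ (o : Labelled m) → Valid o × Represents o π f
represented {m} {hi} {π} {f} ((bounds , inj) , inv , fpf) c = o , valid , rep
  where
  letter : ∀ i → ∃ λ (x : Signed (Fin m)) → toℤ x ≡ lookup π i
  letter i = toℤ-surjective (lookup π i) (proj₁ (bounds i)) (proj₂ (bounds i))
  o : Labelled m
  o i = lookup f i , proj₁ (letter i)
  rep : Represents o π f
  rep = record { values = λ i → sym (proj₂ (letter i)) ; labels = λ _ → refl }
  swap : ∀ i x → lookup π i ≡ toℤ x → lookup π ∣ x ∣ ≡ toℤ (i <$ x)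
  swap i (plus j) = proj₁ (inv i j)
  swap i (minus j) = proj₂ (inv i j)
  -- `Compatible` yields only weak inequalities between letters; distinctness makes them strict.
  values-distinct : ∀ {i j} → i Fin.< j → value o i ≢ value o j
  values-distinct {i} {j} i<j eq = ℕP.<-irrefl (cong toℕ (inj i j (cong ℤ.∣_∣
    (trans (sym (proj₂ (letter i))) (trans (cong toℤ eq) (proj₂ (letter j))))))) i<j
  valid : Valid o
  valid = record
    { involutive = λ i → toℤ-injective (trans (proj₂ (letter ∣ value o i ∣)) (swap i (value o i) (sym (proj₂ (letter i)))))
    ; fixedPointFree = λ i eq → fpf i (trans (cong ℤ.∣_∣ (sym (proj₂ (letter i)))) (trans (∣toℤ∣ (value o i)) (cong pos eq)))
    ; increasing = λ i j i<j → Sum.map₂ (map₂ (toℤ-cancel (values-distinct i<j)))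
        (subst₂ (λ x y → (label o i , x) ⊑ (label o j , y)) (sym (proj₂ (letter i))) (sym (proj₂ (letter j))) (compatible-increasing c i<j))
    ; negative = λ {i} eq → positive (subst (λ x → (0 , + 0) ⊑ (label o i , x)) (trans (sym (proj₂ (letter i))) (cong toℤ eq)) (compatible-head c i))
    }
    where
    positive : ∀ {l b} → (0 , + 0) ⊑ (l , -[1+ b ]) → 1 ≤ l
    positive (inj₁ 0<l) = 0<l

-- Passing to vectors turns pointwise equality of functions into the propositional equality that
-- list membership uses.
encode : ∀ {m} → Labelled m → SignedWord m × Vec ℕ m
encode o = tabulate (toℤ ∘ value o) , tabulate (label o)

encode-represents : ∀ {m} (o : Labelled m) → Represents o (proj₁ (encode o)) (proj₂ (encode o))
encode-represents o = record { values = VecP.lookup∘tabulate (toℤ ∘ value o) ; labels = VecP.lookup∘tabulate (label o) }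

represents⇒encode : ∀ {m} {o : Labelled m} {π f} → Represents o π f → encode o ≡ (π , f)
represents⇒encode {π = π} {f} rep = cong₂ _,_
  (trans (VecP.tabulate-cong (sym ∘ values)) (VecP.tabulate∘lookup π))
  (trans (VecP.tabulate-cong (sym ∘ labels)) (VecP.tabulate∘lookup f))
  where open Represents rep

encode-cong : ∀ {m} {o o′ : Labelled m} → (∀ u → o u ≡ o′ u) → encode o ≡ encode o′
encode-cong eq = cong₂ _,_ (VecP.tabulate-cong (cong (toℤ ∘ proj₂) ∘ eq)) (VecP.tabulate-cong (cong proj₁ ∘ eq))

encode-injective : ∀ {m} {o o′ : Labelled m} → encode o ≡ encode o′ → ∀ u → o u ≡ o′ u
encode-injective {o = o} {o′} eq u = cong₂ _,_
  (trans (sym (VecP.lookup∘tabulate (label o) u)) (trans (cong (λ v → lookup (proj₂ v) u) eq) (VecP.lookup∘tabulate (label o′) u)))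
  (toℤ-injective (trans (sym (VecP.lookup∘tabulate (toℤ ∘ value o) u)) (trans (cong (λ v → lookup (proj₁ v) u) eq) (VecP.lookup∘tabulate (toℤ ∘ value o′) u))))

fpfInvolutions : ∀ m → List (SignedWord m)
fpfInvolutions m = filter (fpfInvolution? m) (words (signedLetters m) m)

labelledInvolutions : ∀ r m → List (SignedWord m × Vec ℕ m)
labelledInvolutions r m = fibres _,_ (labellings 0 (suc r) (+ 0)) (fpfInvolutions m)

labelledInvolutions-unique : ∀ r m → Unique (labelledInvolutions r m)
labelledInvolutions-unique r m = fibres-unique _,_ (labellings 0 (suc r) (+ 0)) (λ { refl → refl , refl })
  (labellings-unique 0 (suc r) (+ 0)) (UniqueP.filter⁺ (fpfInvolution? m) (words-unique (signedLetters-unique m) m))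

-- Duplicate-free lists with the same members have equal length; `to` rests on completeness of
-- `assemble`, `from` on its soundness.
length-labelledInvolutions : ∀ r n → length (labelledInvolutions r (double n)) ≡ multichoose (r ℕ.* suc r) n
length-labelledInvolutions r n = begin
  length (labelledInvolutions r (double n))
    ≡⟨ ↭-length (∼bag⇒↭ (unique∧set⇒bag (labelledInvolutions-unique r (double n)) assembled-unique (mk⇔ to from))) ⟩
  length (map (encode ∘ assemble) (multisets (symbols r) n)) ≡⟨ ListP.length-map (encode ∘ assemble) (multisets (symbols r) n) ⟩
  length (multisets (symbols r) n)                          ≡⟨ length-multisets (symbols r) n ⟩
  multichoose (length (symbols r)) n                        ≡⟨ cong (λ c → multichoose c n) (length-symbols r) ⟩
  multichoose (r ℕ.* suc r) n                               ∎
  where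
  open ≡-Reasoning

  assembled-unique : Unique (map (encode ∘ assemble) (multisets (symbols r) n))
  assembled-unique = UniqueP.map⁺ (λ {w} {w′} eq → assemble-injective w w′ (encode-injective eq)) (multisets-unique (symbols-unique r) n)

  to : ∀ {p} → p ∈ labelledInvolutions r (double n) → p ∈ map (encode ∘ assemble) (multisets (symbols r) n)
  to p∈ with ∈-fibres⁻ _,_ (labellings 0 (suc r) (+ 0)) (fpfInvolutions (double n)) p∈
  ... | π , f , π∈ , f∈ , refl =
    subst (_∈ _) (trans (encode-cong (proj₂ (proj₂ assembled))) (represents⇒encode rep)) (∈-map⁺ (encode ∘ assemble) (proj₁ (proj₂ assembled)))
    where
    c = ∈-labellings⁻ 0 (suc r) (+ 0) refl f∈
    ov = represented (proj₂ (∈-filter⁻ (fpfInvolution? (double n)) {xs = words (signedLetters (double n)) (double n)} π∈)) c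
    o = proj₁ ov
    rep = proj₂ (proj₂ ov)
    assembled = assemble-complete (symbols r) n o (proj₁ (proj₂ ov)) (symbols-descending r) (symbols-downClosed r)
      (λ u can → ∈-symbols⁺ r can (ℕP.≤-pred (subst (ℕ._< suc r) (Represents.labels rep u) (compatible-bound c u))))

  from : ∀ {p} → p ∈ map (encode ∘ assemble) (multisets (symbols r) n) → p ∈ labelledInvolutions r (double n)
  from p∈ with ∈-map⁻ (encode ∘ assemble) p∈
  ... | w , w∈ , refl = ∈-fibres⁺ _,_ (labellings 0 (suc r) (+ 0))
    (∈-filter⁺ (fpfInvolution? (double n))
      (∈-words⁺ (proj₁ (encode o)) (λ i → subst (_∈ signedLetters (double n)) (sym (Represents.values rep i)) (toℤ-∈ (value o i))))
      (represent-fpf rep valid))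
    (∈-labellings⁺ 0 (suc r) (+ 0) refl (represent-compatible rep valid (λ u → s≤s (lex⇒≤ (bounded u)))))
    where
    o = assemble w
    rep = encode-represents o
    sound = assemble-sound (All.map proj₁ (symbols-canonical r)) (symbols-descending r) w∈
    valid = proj₁ sound
    -- `(r , plus r)` is not canonical; it merely bounds the list from above, which gives labels at
    -- most `r`.
    below-r : ∀ {x} → Canonical x × proj₁ x ≤ r → x ≼ (r , plus r)
    below-r (minus _ _ , a≤r) with ℕP.m≤n⇒m<n∨m≡n a≤r
    ... | inj₁ a<r = inj₁ a<r
    ... | inj₂ a≡r = inj₂ (a≡r , minus-plus)
    below-r (plus b<a , a≤r) with ℕP.m≤n⇒m<n∨m≡n a≤r
    ... | inj₁ a<r  = inj₁ a<r
    ... | inj₂ refl = inj₂ (refl , plus (ℕP.<⇒≤ b<a))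
    bounded = proj₂ sound (r , plus r) (All.map below-r (symbols-canonical r))

-- Counting fibres by a statistic

private
  δ : ℕ → ℕ → ℤ
  δ d k with d ℕ.≟ k
  ... | yes _ = + 1
  ... | no  _ = + 0

  δ-≢ : ∀ {d k} → d ≢ k → δ d k ≡ + 0
  δ-≢ {d} {k} d≢k with d ℕ.≟ k
  ... | yes d≡k = contradiction d≡k d≢k
  ... | no  _   = refl

  ∑<-δ : ∀ K d (w : ℕ → ℤ) → (K ≤ d → w d ≡ + 0) → ∑< K (λ k → δ d k * w k) ≡ w d
  ∑<-δ zero    d w vanish = sym (vanish z≤n)
  ∑<-δ (suc K) d w vanish with d ℕ.≟ K
  ... | yes refl = trans (cong₂ _+_ (∑<-zero K (λ k k<K → cong (_* w k) (δ-≢ (ℕP.<⇒≢ k<K ∘ sym)))) refl)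
                         (trans (ℤP.+-identityˡ (+ 1 * w d)) (ℤP.*-identityˡ (w d)))
  ... | no d≢K = trans (cong₂ _+_ (∑<-δ K d w (λ K≤d → vanish (ℕP.≤∧≢⇒< K≤d (d≢K ∘ sym)))) refl)
                       (ℤP.+-identityʳ (w d))

module _ {A B : Set} {P : A → Set} {Q : ℕ → A → Set} (P? : ∀ x → Dec (P x)) (Q? : ∀ k x → Dec (Q k x)) (stat : A → ℕ)
         (Q⇒P : ∀ {k x} → Q k x → P x × stat x ≡ k) (P⇒Q : ∀ {x} → P x → Q (stat x) x)
         (g : A → List B) (w : ℕ → ℤ) (K : ℕ)
         (fibre : ∀ x → + length (g x) ≡ w (stat x)) (vanish : ∀ k → K ≤ k → w k ≡ + 0) where

  private
    count : List A → ℕ → ℤ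
    count xs k = + length (filter (Q? k) xs)

    count-∷ : ∀ {x} xs → P x → ∀ k → count (x ∷ xs) k ≡ δ (stat x) k + count xs k
    count-∷ {x} xs px k with stat x ℕ.≟ k
    ... | yes refl = cong (+_ ∘ length) (ListP.filter-accept (Q? k) (P⇒Q px))
    ... | no  d≢k  = trans (cong (+_ ∘ length) (ListP.filter-reject (Q? k) (d≢k ∘ proj₂ ∘ Q⇒P)))
                       (sym (ℤP.+-identityˡ (count xs k)))

  -- Each `x` satisfying `P` contributes `w (stat x)`, which `∑<-δ` rewrites as a sum over `k`;
  -- values of the statistic from `K` on contribute nothing because `w` vanishes there.
  length-fibres-by-statistic : ∀ xs → + length (fibres _,_ g (filter P? xs)) ≡ ∑< K (λ k → count xs k * w k)
  length-fibres-by-statistic [] = sym (∑<-zero K (λ k _ → refl))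
  length-fibres-by-statistic (x ∷ xs) with P? x
  ... | no ¬px = trans (length-fibres-by-statistic xs) (∑<-cong K (λ k → cong (λ l → + length l * w k)
                   (sym (ListP.filter-reject (Q? k) (¬px ∘ proj₁ ∘ Q⇒P)))))
  ... | yes px = begin
    + length (map (x ,_) (g x) ++ rest)
      ≡⟨ cong +_ (trans (ListP.length-++ (map (x ,_) (g x))) (cong (ℕ._+ length rest) (ListP.length-map (x ,_) (g x)))) ⟩
    + (length (g x) ℕ.+ length rest)
      ≡⟨ ℤP.pos-+ (length (g x)) (length rest) ⟩
    + length (g x) + + length rest
      ≡⟨ cong₂ _+_ (trans (fibre x) (sym (∑<-δ K (stat x) w (vanish (stat x))))) (length-fibres-by-statistic xs) ⟩
    ∑< K (λ k → δ (stat x) k * w k) + ∑< K (λ k → count xs k * w k)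
      ≡⟨ ∑<-+ K (λ k → δ (stat x) k * w k) (λ k → count xs k * w k) ⟨
    ∑< K (λ k → δ (stat x) k * w k + count xs k * w k)
      ≡⟨ ∑<-cong K (λ k → trans (sym (ℤP.*-distribʳ-+ (w k) (δ (stat x) k) (count xs k))) (cong (_* w k) (sym (count-∷ xs px k)))) ⟩
    ∑< K (λ k → count (x ∷ xs) k * w k) ∎
    where
    open ≡-Reasoning
    rest = fibres _,_ g (filter P? xs)

-- The expansion for J and the recurrence

JB-expansion : ∀ n r → ∑< (suc r) (λ k → + JB (double (suc n)) (+ k) * M (suc r ℕ.∸ k) (double (suc n))) ≡ M (r ℕ.* suc r) (suc n)
JB-expansion n r = trans
  (sym (length-fibres-by-statistic (fpfInvolution? m) (λ k → fpfInvDes? m (+ k)) desB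
    (λ { (sp , inv , fpf , eq) → (sp , inv , fpf) , ℤP.+-injective eq }) (λ { (sp , inv , fpf) → sp , inv , fpf , refl })
    (labellings 0 (suc r) (+ 0)) (λ k → M (suc r ℕ.∸ k) m) (suc r)
    (λ π → cong +_ (length-labellings 0 (suc r) (+ 0) π))
    -- Since `m` is positive, ((0 , m)) = 0: a word with more than `r` descents has no labelling by
    -- 0, ..., r.
    (λ k r<k → cong (λ c → M c m) (ℕP.m≤n⇒m∸n≡0 r<k))
    (words (signedLetters m) m)))
  (cong +_ (length-labelledInvolutions r (suc n)))
  where m = double (suc n)

JB-negative : ∀ m k → JB m -[1+ k ] ≡ 0
JB-negative m k = cong length (ListP.filter-none (fpfInvDes? m -[1+ k ]) (All.universal (λ { _ (_ , _ , _ , ()) }) (words (signedLetters m) m)))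

double≡2* : ∀ n → double n ≡ 2 ℕ.* n
double≡2* zero    = refl
double≡2* (suc n) = cong suc (trans (cong suc (double≡2* n)) (sym (ℕP.+-suc n (n ℕ.+ 0))))

delayed : ∀ m k → delay (λ k → + JB m (+ k)) k ≡ + JB m (+ k - + 1)
delayed m zero    = cong +_ (sym (JB-negative m 0))
delayed m (suc k) = refl

delayed² : ∀ m k → delay (delay (λ k → + JB m (+ k))) k ≡ + JB m (+ k - + 2)
delayed² m zero          = cong +_ (sym (JB-negative m 1))
delayed² m (suc zero)    = cong +_ (sym (JB-negative m 0))
delayed² m (suc (suc k)) = refl

theorem1p7 : (JB 2 (+ 0) ≡ 0 × JB 2 (+ 1) ≡ 2 × JB 2 (+ 2) ≡ 0) ×
    (∀ (n k : ℕ) → 2 ≤ n →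
    (+ n) * (+ JB (2 ℕ.* n) (+ k))
    ≡ ((+ k) * (+ k) + (+ k) + (+ n) - + 1) * (+ JB (2 ℕ.* n ℕ.∸ 2) (+ k))
    + (+ 2) * (((+ k) - + 1) * ((+ 2) * (+ n) - (+ k) - + 1) + (+ n))
    * (+ JB (2 ℕ.* n ℕ.∸ 2) ((+ k) - + 1))
    + (((+ 2) * (+ n) - (+ k)) * ((+ 2) * (+ n) - (+ k) + + 1) + ((+ n) - + 1))
    * (+ JB (2 ℕ.* n ℕ.∸ 2) ((+ k) - + 2)))
theorem1p7 = (refl , refl , refl) , rec
  where
  -- The length is a parameter so that the proof can run at `double n`, where `m ℕ.∸ 2` reduces,
  -- before being transported to `2 ℕ.* n`.
  Recurrence : ℕ → ℕ → ℕ → Set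
  Recurrence n k m = (+ n) * (+ JB m (+ k)) ≡ coeff₀ (+ n) (+ k) * (+ JB (m ℕ.∸ 2) (+ k))
    + coeff₁ (+ n) (+ k) * (+ JB (m ℕ.∸ 2) (+ k - + 1)) + coeff₂ (+ n) (+ k) * (+ JB (m ℕ.∸ 2) (+ k - + 2))

  rec : ∀ n k → 2 ≤ n → Recurrence n k (2 ℕ.* n)
  rec (suc (suc n)) k (s≤s (s≤s _)) = subst (Recurrence (2 ℕ.+ n) k) (double≡2* (2 ℕ.+ n))
    (trans (recurrence (suc n) (suc (double n)) (sym (double≡2* (2 ℕ.+ n))) (λ k → + JB (double (2 ℕ.+ n)) (+ k)) J′
             (JB-expansion (suc n)) (JB-expansion n) k)
      (cong₂ (λ x y → coeff₀ N (+ k) * J′ k + coeff₁ N (+ k) * x + coeff₂ N (+ k) * y)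
        (delayed (double (suc n)) k) (delayed² (double (suc n)) k)))
    where
    N = + suc (suc n)
    J′ : ℕ → ℤ
    J′ k = + JB (double (suc n)) (+ k)
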